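{- Let $\mathbb{F}_q=GF(q)$ be a finite field with $q>2$ elements. There exists a randomized algorithm that, given integers $d,n,k\ge 1$ and a matrix $A\in\mathbb{F}_q^{d\times n}$, uses runtime $O\bigl(d\,k\cdot (n(q-1))^{\lceil k/2\rceil}\bigr)$ and satisfies the following: (i) if $A$ has Kruskal rank less than $k$ over $GF(q)$, then the algorithm reports that $A$ has Kruskal rank less than $k$; (ii) if $A$ has Kruskal rank at least $k$ over $GF(q)$, then with probability at least $0.99$ the algorithm reports that $A$ has Kruskal rank at least $k$.
   Context: The Kruskal rank of a matrix $A$ over a field $F$ is the largest integer $r$ such that every set of $r$ columns of $A$ (columns indexed by $\{1,\dots,n\}$) is linearly independent over $F$. The algorithm outputs one of the two reports "Kruskal rank less than $k$" or "Kruskal rank at least $k$", and probability is over its internal randomness. Runtime convention: the algorithm may use a uniformly random hash function $h:\mathbb{F}_q^d\to\{1,\dots,b\}$ and a hash table with $b$ buckets, and processing one linear combination of columns in $\mathbb{F}_q^d$ (forming it, evaluating $h$ on it, and accessing its bucket) is counted as $O(d)$ time. The constant in $O(\cdot)$ is absolute (independent of $d,n,k,q$). -}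

module Defs where

open import Algebra.Bundles using (CommutativeRing)
open import Data.Bool.Base using (if_then_else_)
open import Data.Fin.Base using (Fin; toℕ; fromℕ<; funToFin; finToFun)
open import Data.Fin.Subset using (Subset; ∣_∣; _∈_; _∉_)
open import Data.Integer.Base using (+_)
open import Data.List.Base using (length; filter; allFin)
open import Data.Nat.Base using (ℕ; zero; suc; NonZero; _+_; _*_; _∸_; _^_; _≤_)
open import Data.Nat.GeneralisedArithmetic using (fold)
open import Data.Nat.Properties using (_≟_; _<?_; m^n≢0)
open import Data.Product.Base using (∃; _×_)
open import Data.Rational.Unnormalised.Base using (ℚᵘ; _/_)
open import Data.Vec.Functional using (Vector)
open import Function.Base using (_∘_)
open import Function.Bundles using (Inverse)
open import Level using (0ℓ)
open import Relation.Binary.Definitions using (DecidableEquality)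
open import Relation.Binary.PropositionalEquality using (_≡_; refl; setoid)
open import Relation.Nullary using (¬_; yes; no; does)
open import Relation.Unary using (Decidable)

import Algebra.Properties.CommutativeMonoid.Sum as Sum

------------------------------------------------------------------------
-- Finite fields

record FiniteField (q : ℕ) : Set₁ where
  field
    commutativeRing : CommutativeRing 0ℓ 0ℓ

  open CommutativeRing commutativeRing public
    renaming (_+_ to _+ᶠ_; _*_ to _*ᶠ_; setoid to setoidᶠ)

  field
    1≉0         : ¬ (1# ≈ 0#)
    inverse     : ∀ x → ¬ (x ≈ 0#) → ∃ λ y → x *ᶠ y ≈ 1#
    enumeration : Inverse setoidᶠ (setoid (Fin q))

  open Sum +-commutativeMonoid public using (sum)

-- d rows, n columns.
Matrix : ∀ {q} → FiniteField q → ℕ → ℕ → Set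
Matrix F d n = Vector (Vector (FiniteField.Carrier F) n) d

------------------------------------------------------------------------
-- Kruskal rank

module _ {q : ℕ} (F : FiniteField q) {d n : ℕ} (A : Matrix F d n) where
  open FiniteField F using (Carrier; _≈_; _*ᶠ_; 0#; sum)

  -- A linear combination of the columns in S is given by coefficients for
  -- all columns, vanishing outside S.
  IndependentColumns : Subset n → Set
  IndependentColumns S =
    (x : Vector Carrier n) →
    (∀ j → j ∉ S → x j ≈ 0#) →
    (∀ i → sum (λ j → x j *ᶠ A i j) ≈ 0#) →
    ∀ j → j ∈ S → x j ≈ 0#

  AllIndependent : ℕ → Set
  AllIndependent r = ∀ S → ∣ S ∣ ≡ r → IndependentColumns S

  -- Without r ≤ n the maximum would not exist: AllIndependent r holds
  -- vacuously for r > n.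
  IsKruskalRank : ℕ → Set
  IsKruskalRank r =
    (r ≤ n × AllIndependent r) ×
    (∀ s → s ≤ n → AllIndependent s → s ≤ r)

------------------------------------------------------------------------
-- Programs for a unit-cost random access machine.  Natural numbers admit
-- only addition and truncated subtraction; vectors in 𝔽_q^d can be reset
-- to 0, updated by a multiple of a column of A, and hashed.

infixl 6 _⊕_ _⊖_
infix  8 _[_]

data Expr : Set where
  lit     : ℕ → Expr
  var     : ℕ → Expr
  _[_]    : ℕ → Expr → Expr
  _⊕_ _⊖_ : Expr → Expr → Expr

infixr 2 _⨾_
infix  3 _≔_ _[_]≔_

data Stmt : Set where
  skip    : Stmt
  _≔_     : (x : ℕ) → Expr → Stmt
  _[_]≔_  : (a : ℕ) → Expr → Expr → Stmt
  _⨾_     : Stmt → Stmt → Stmt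
  ifZero  : Expr → Stmt → Stmt → Stmt
  -- The number of iterations is fixed on entry.
  loop    : Expr → Stmt → Stmt
  clear   : (v : ℕ) → Stmt
  -- addCol v c j adds to vector v the c-th field element times column j.
  addCol  : (v : ℕ) → (c j : Expr) → Stmt
  hash    : (x v : ℕ) → Stmt

_[_↦_] : ∀ {X : Set} → (ℕ → X) → ℕ → X → (ℕ → X)
(f [ x ↦ a ]) y = if does (x ≟ y) then a else f y

module Machine {q : ℕ} (F : FiniteField q) {d n : ℕ} (A : Matrix F d n) where
  open FiniteField F using (Carrier; _+ᶠ_; _*ᶠ_; 0#; enumeration)

  Vec : Set
  Vec = Vector Carrier d

  record State : Set where
    constructor ⟨_,_,_⟩
    field
      vars : ℕ → ℕ
      arrs : ℕ → ℕ → ℕ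
      vecs : ℕ → Vec

  open State public

  -- Field elements and columns are numbered from 0; anything out of range
  -- denotes 0.
  element : ℕ → Carrier
  element c with c <? q
  ... | yes c<q = Inverse.from enumeration (fromℕ< c<q)
  ... | no  _   = 0#

  column : ℕ → Vec
  column j i with j <? n
  ... | yes j<n = A i (fromℕ< j<n)
  ... | no  _   = 0#

  -- The number of a vector in the enumeration of 𝔽_q^d.
  index : Vec → Fin (q ^ d)
  index v = funToFin (Inverse.to enumeration ∘ v)

  ⟦_⟧ : Expr → State → ℕ
  ⟦ lit m    ⟧ σ = m
  ⟦ var x    ⟧ σ = vars σ x
  ⟦ a [ e ]  ⟧ σ = arrs σ a (⟦ e ⟧ σ)
  ⟦ e₁ ⊕ e₂  ⟧ σ = ⟦ e₁ ⟧ σ + ⟦ e₂ ⟧ σ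
  ⟦ e₁ ⊖ e₂  ⟧ σ = ⟦ e₁ ⟧ σ ∸ ⟦ e₂ ⟧ σ

  size : Expr → ℕ
  size (lit _)   = 1
  size (var _)   = 1
  size (_ [ e ]) = 1 + size e
  size (e₁ ⊕ e₂) = 1 + size e₁ + size e₂
  size (e₁ ⊖ e₂) = 1 + size e₁ + size e₂

  module _ (h : Fin (q ^ d) → ℕ) where

    exec : Stmt → State → State
    exec skip           σ = σ
    exec (x ≔ e)        σ = record σ { vars = vars σ [ x ↦ ⟦ e ⟧ σ ] }
    exec (a [ e₁ ]≔ e₂) σ =
      record σ { arrs = arrs σ [ a ↦ arrs σ a [ ⟦ e₁ ⟧ σ ↦ ⟦ e₂ ⟧ σ ] ] }
    exec (s₁ ⨾ s₂)      σ = exec s₂ (exec s₁ σ)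
    exec (ifZero e s t) σ with ⟦ e ⟧ σ
    ... | zero  = exec s σ
    ... | suc _ = exec t σ
    exec (loop e s)     σ = fold σ (exec s) (⟦ e ⟧ σ)
    exec (clear v)      σ = record σ { vecs = vecs σ [ v ↦ (λ _ → 0#) ] }
    exec (addCol v c j) σ =
      record σ { vecs = vecs σ [ v ↦ (λ i →
        vecs σ v i +ᶠ element (⟦ c ⟧ σ) *ᶠ column (⟦ j ⟧ σ) i) ] }
    exec (hash x v)     σ =
      record σ { vars = vars σ [ x ↦ h (index (vecs σ v)) ] }

    time : Stmt → State → ℕ
    time skip           σ = 1
    time (x ≔ e)        σ = 1 + size e
    time (a [ e₁ ]≔ e₂) σ = 1 + size e₁ + size e₂
    time (s₁ ⨾ s₂)      σ = time s₁ σ + time s₂ (exec s₁ σ)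
    time (ifZero e s t) σ with ⟦ e ⟧ σ
    ... | zero  = 1 + size e + time s σ
    ... | suc _ = 1 + size e + time t σ
    time (loop e s)     σ = 1 + size e + iterations (⟦ e ⟧ σ)
      where
      iterations : ℕ → ℕ
      iterations zero    = 0
      iterations (suc m) = iterations m + (1 + time s (fold σ (exec s) m))
    time (clear v)      σ = d
    time (addCol v c j) σ = size c + size j + d
    time (hash x v)     σ = d

------------------------------------------------------------------------
-- Randomized algorithms and their runs

data Report : Set where
  lessThan atLeast : Report

_≟ᴿ_ : DecidableEquality Report
lessThan ≟ᴿ lessThan = yes refl
lessThan ≟ᴿ atLeast  = no λ ()
atLeast  ≟ᴿ lessThan = no λ ()
atLeast  ≟ᴿ atLeast  = yes refl

-- The first phase runs before the hash function is drawn and fixes the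
-- number of buckets; the second phase continues from its final state.
record Algorithm : Set where
  field
    setup : Stmt
    main  : Stmt

module Run {q : ℕ} (F : FiniteField q) (alg : Algorithm)
           {d n : ℕ} (k : ℕ) (A : Matrix F d n) where
  open FiniteField F using (0#)
  open Machine F A
  open Algorithm alg

  initial : State
  initial = ⟨ (λ _ → 0) [ 2 ↦ k ] [ 1 ↦ n ] [ 0 ↦ d ]
            , (λ _ _ → 0)
            , (λ _ _ → 0#) ⟩

  noHash : Fin (q ^ d) → ℕ
  noHash _ = 0

  ready : State
  ready = exec noHash setup initial

  -- Variable 0 holds the number of buckets minus one, so that there is
  -- at least one bucket.
  buckets : ℕ
  buckets = suc (vars ready 0)

  -- The sample space: all functions Fin (q ^ d) → Fin buckets, numbered
  -- by finToFun.
  Ω : ℕ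
  Ω = buckets ^ (q ^ d)

  instance
    Ω-nonZero : NonZero Ω
    Ω-nonZero = m^n≢0 buckets (q ^ d)

  hashFunction : Fin Ω → Fin (q ^ d) → ℕ
  hashFunction ω = toℕ ∘ finToFun ω

  runtime : Fin Ω → ℕ
  runtime ω = time noHash setup initial + time (hashFunction ω) main ready

  report : Fin Ω → Report
  report ω with vars (exec (hashFunction ω) main ready) 0
  ... | zero  = lessThan
  ... | suc _ = atLeast

-- Probability under the uniform distribution on Fin N.
Pr : ∀ {N} .{{_ : NonZero N}} {P : Fin N → Set} → Decidable P → ℚᵘ
Pr {N} P? = + length (filter P? (allFin N)) / N

{-# OPTIONS --safe #-}
module Submission where

-- The linear combinations with nonzero coefficients of at most ⌈ k /2⌉ columns
-- are the nodes of the complete n (q ∸ 1)-ary tree of depth ⌈ k /2⌉ whose column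
-- indices ascend along the path to the root; the tree has at most
-- 2 (n (q ∸ 1)) ^ ⌈ k /2⌉ nodes.  A nonzero linear combination of k columns
-- that vanishes splits into two different nodes with the same vector, one of
-- them with at most ⌊ k /2⌋ columns, and conversely such a pair of nodes is a
-- dependency of at most k columns.  So the algorithm answers lessThan as soon as
-- two such nodes share a bucket.  The error is one-sided: if any k columns are
-- independent, it comes from two different vectors with the same hash value.
-- With b buckets and L nodes the fraction of the hash functions for which this
-- happens is at most L² / b, and b = 100 L² + 1.

open import Data.Bool.Base using (if_then_else_)
open import Data.Fin.Base as Fin using
  (Fin; zero; suc; toℕ; fromℕ<; punchIn; punchOut; combine; remQuot; funToFin; finToFun)
open import Data.Fin.Properties as Finₚ using
  (toℕ<n; toℕ-fromℕ<; toℕ-injective; fromℕ<-toℕ; punchIn-injective; punchInᵢ≢i; punchIn-punchOut)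
open import Data.Fin.Subset using (Subset; inside; outside; ∣_∣; _∈_; _∉_; _⊆_; ⊥)
open import Data.Fin.Subset.Properties using (_∈?_; ∣⊥∣≡0; out⊆; s⊆s)
import Data.Integer.Base as ℤ
import Data.Integer.Properties as ℤₚ
open import Data.List.Base using
  (List; []; _∷_; _++_; length; map; take; drop; filter; lookup; allFin)
open import Data.List.Properties using
  (∷-injectiveˡ; length-++; length-map; length-take; length-drop; length-tabulate; take++drop≡id)
open import Data.List.Membership.Propositional using () renaming (_∈_ to _∈ˡ_)
open import Data.List.Membership.Propositional.Properties using (∈-lookup; ∈-filter⁻)
open import Data.List.Relation.Unary.All as All using (All; []; _∷_)
import Data.List.Relation.Unary.All.Properties as Allₚ
open import Data.List.Relation.Unary.AllPairs as AllPairs using (AllPairs; []; _∷_)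
import Data.List.Relation.Unary.AllPairs.Properties as AllPairsₚ
open import Data.List.Relation.Unary.Unique.Propositional using (Unique)
open import Data.List.Relation.Unary.Unique.Propositional.Properties using (filter⁺; allFin⁺)
open import Data.Nat.Base using
  (ℕ; zero; suc; pred; _+_; _*_; _∸_; _^_; _≤_; _<_; z≤n; s≤s; ⌊_/2⌋; ⌈_/2⌉; NonZero; >-nonZero)
open import Data.Nat.GeneralisedArithmetic using (fold)
import Data.Nat.Properties as ℕ
open import Data.Nat.Solver using (module +-*-Solver)
open import Data.Product.Base using (∃; _×_; _,_; proj₁; proj₂; map₁; map₂; uncurry)
open import Data.Rational.Unnormalised.Base using (_/_; *≤*) renaming (_≤_ to _≤ᵘ_)
open import Data.Sum.Base using (_⊎_; inj₁; inj₂)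
open import Data.Vec.Base using ([]; _∷_; here; there)
open import Data.Vec.Functional using (Vector; updateAt)
open import Data.Vec.Functional.Properties using (updateAt-updates; updateAt-minimal)
open import Function.Base using (_∘_; _on_; const; case_of_)
open import Function.Bundles using (Inverse)
open import Function.Definitions using (Injective)
open import Relation.Binary.Definitions using (tri<; tri≈; tri>)
open import Relation.Binary.PropositionalEquality as ≡ using
  (_≡_; _≢_; refl; cong; cong₂; sym; trans)
open import Relation.Nullary using (¬_; Dec; yes; no; contradiction)
open import Relation.Nullary.Decidable using (dec-true; dec-false)
open import Defs

import Algebra.Properties.CommutativeMonoid.Sum as Sum
import Algebra.Properties.Ring as Ringₚ
import Relation.Binary.Reasoning.Setoid as SetoidReasoning

enlarge : ∀ {n r} (p : Subset n) → ∣ p ∣ ≤ r → r ≤ n → ∃ λ s → p ⊆ s × ∣ s ∣ ≡ r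
enlarge [] z≤n z≤n = [] , (λ ()) , refl
enlarge {r = zero} (outside ∷ p) p≤r r≤n =
  let s , p⊆s , eq = enlarge p p≤r z≤n in outside ∷ s , s⊆s p⊆s , eq
enlarge {r = suc r} (outside ∷ p) p≤r (s≤s r≤n) with ∣ p ∣ ℕ.≤? r
... | yes p≤r′ = let s , p⊆s , eq = enlarge p p≤r′ r≤n in inside ∷ s , out⊆ p⊆s , cong suc eq
... | no  p≰r  =
  outside ∷ p , (λ x → x) , ℕ.≤-antisym p≤r (ℕ.≰⇒> p≰r)
enlarge {r = suc r} (inside ∷ p) (s≤s p≤r) (s≤s r≤n) =
  let s , p⊆s , eq = enlarge p p≤r r≤n in inside ∷ s , s⊆s p⊆s , cong suc eq

insert : ∀ {n} → Fin n → Subset n → Subset n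
insert zero    (_ ∷ p) = inside ∷ p
insert (suc j) (s ∷ p) = s ∷ insert j p

∈-insert : ∀ {n} (j : Fin n) p → j ∈ insert j p
∈-insert zero    (_ ∷ p) = here
∈-insert (suc j) (_ ∷ p) = there (∈-insert j p)

⊆-insert : ∀ {n} (j : Fin n) p → p ⊆ insert j p
⊆-insert zero    (_ ∷ p) here     = here
⊆-insert zero    (_ ∷ p) (there x) = there x
⊆-insert (suc j) (_ ∷ p) (here)      = here
⊆-insert (suc j) (_ ∷ p) (there x) = there (⊆-insert j p x)

∣insert∣≤ : ∀ {n} (j : Fin n) p → ∣ insert j p ∣ ≤ suc ∣ p ∣
∣insert∣≤ zero    (inside  ∷ p) = ℕ.n≤1+n _
∣insert∣≤ zero    (outside ∷ p) = ℕ.≤-refl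
∣insert∣≤ (suc j) (inside  ∷ p) = s≤s (∣insert∣≤ j p)
∣insert∣≤ (suc j) (outside ∷ p) = ∣insert∣≤ j p


-- Linear combinations as lists of nonzero terms

module Sparse {Q : ℕ} (F : FiniteField (suc Q)) where
  open FiniteField F using
    ( Carrier; _≈_; _+ᶠ_; _*ᶠ_; -_; 0#; sum; enumeration; setoidᶠ; ring
    ; +-cong; +-congˡ; *-congʳ; -‿cong; +-identityˡ; +-identityʳ
    ; +-assoc; zeroˡ; distribʳ; -‿inverseʳ; +-commutativeMonoid )
  private module K = FiniteField F
  open Ringₚ ring using
    (-0#≈0#; +-cancelˡ; -‿involutive; -‿+-comm; -‿distribˡ-*; +-inverseˡ-unique; x∙y⁻¹≈ε⇒x≈y)
  open Inverse enumeration using (to; from; to-cong; strictlyInverseˡ; strictlyInverseʳ)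
  module Sumₚ = Sum +-commutativeMonoid

  to-injective : ∀ {x y} → to x ≡ to y → x ≈ y
  to-injective {x} {y} eq = begin
    x           ≈⟨ strictlyInverseʳ x ⟨
    from (to x) ≡⟨ cong from eq ⟩
    from (to y) ≈⟨ strictlyInverseʳ y ⟩
    y           ∎
    where open SetoidReasoning setoidᶠ

  _≈?_ : ∀ x y → Dec (x ≈ y)
  x ≈? y with to x Finₚ.≟ to y
  ... | yes eq = yes (to-injective eq)
  ... | no neq = no (neq ∘ to-cong)

  zeroCode : Fin (suc Q)
  zeroCode = to 0#

  -- Numbers the nonzero elements by skipping the number of `0#`, so that a column has exactly `Q`
  -- coefficients and different numbers give different coefficients.
  unit : Fin Q → Carrier
  unit c = from (punchIn zeroCode c)

  unit≉0 : ∀ c → ¬ unit c ≈ 0#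
  unit≉0 c eq = punchInᵢ≢i zeroCode c (trans (sym (strictlyInverseˡ _)) (to-cong eq))

  unit-injective : ∀ {c c′} → unit c ≈ unit c′ → c ≡ c′
  unit-injective eq = punchIn-injective zeroCode _ _
    (trans (sym (strictlyInverseˡ _)) (trans (to-cong eq) (strictlyInverseˡ _)))

  unit-surjective : ∀ y → ¬ y ≈ 0# → ∃ λ c → unit c ≈ y
  unit-surjective y y≉0 = punchOut 0≢y , K.trans
    (K.reflexive (cong from (punchIn-punchOut 0≢y))) (strictlyInverseʳ y)
    where
    0≢y : zeroCode ≢ to y
    0≢y eq = y≉0 (K.sym (to-injective eq))

  Term : ℕ → Set
  Term n = Fin n × Fin Q

  single : ∀ {n} → Fin n → Carrier → Vector Carrier n
  single zero    y zero    = y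
  single zero    y (suc l) = 0#
  single (suc j) y zero    = 0#
  single (suc j) y (suc l) = single j y l

  single-≡ : ∀ {n} (j : Fin n) y → single j y j ≈ y
  single-≡ zero    y = K.refl
  single-≡ (suc j) y = single-≡ j y

  single-≢ : ∀ {n} (j l : Fin n) y → j ≢ l → single j y l ≈ 0#
  single-≢ zero    zero    y j≢l = contradiction refl j≢l
  single-≢ zero    (suc l) y j≢l = K.refl
  single-≢ (suc j) zero    y j≢l = K.refl
  single-≢ (suc j) (suc l) y j≢l = single-≢ j l y (j≢l ∘ cong suc)

  single-neg : ∀ {n} (j l : Fin n) {y y′} → y′ ≈ - y → single j y′ l ≈ - single j y l
  single-neg zero    zero    eq = eq
  single-neg zero    (suc l) eq = K.sym -0#≈0#
  single-neg (suc j) zero    eq = K.sym -0#≈0#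
  single-neg (suc j) (suc l) eq = single-neg j l eq

  sum-zero : ∀ {n} {f : Vector Carrier n} → (∀ l → f l ≈ 0#) → sum f ≈ 0#
  sum-zero {n} f≈0 = K.trans (Sumₚ.sum-cong-≋ f≈0) (Sumₚ.sum-replicate-zero n)

  sum-single : ∀ {n} (j : Fin n) y (a : Vector Carrier n) →
               sum (λ l → single j y l *ᶠ a l) ≈ y *ᶠ a j
  sum-single zero    y a = K.trans
    (+-congˡ (sum-zero (λ l → zeroˡ (a (suc l))))) (+-identityʳ _)
  sum-single (suc j) y a = K.trans
    (+-cong (zeroˡ (a zero)) (sum-single j y (a ∘ suc))) (+-identityˡ _)

  -- The lists are arbitrary paths of the tree: columns may be unsorted, and repeated ones add up.
  vector : ∀ {n} → List (Term n) → Vector Carrier n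
  vector []             l = 0#
  vector ((j , c) ∷ es) l = single j (unit c) l +ᶠ vector es l

  vector-++ : ∀ {n} es fs (l : Fin n) → vector (es ++ fs) l ≈ vector es l +ᶠ vector fs l
  vector-++ []             fs l = K.sym (+-identityˡ _)
  vector-++ ((j , c) ∷ es) fs l =
    K.trans (+-congˡ (vector-++ es fs l)) (K.sym (+-assoc _ _ _))

  -unit≉0 : ∀ c → ¬ - unit c ≈ 0#
  -unit≉0 c eq = unit≉0 c (K.trans (K.sym (-‿involutive _)) (K.trans (-‿cong eq) -0#≈0#))

  negateTerm : ∀ {n} → Term n → Term n
  negateTerm (j , c) = j , proj₁ (unit-surjective (- unit c) (-unit≉0 c))

  unit-negateTerm : ∀ {n} (e : Term n) → unit (proj₂ (negateTerm e)) ≈ - unit (proj₂ e)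
  unit-negateTerm (j , c) = proj₂ (unit-surjective (- unit c) (-unit≉0 c))

  negate : ∀ {n} → List (Term n) → List (Term n)
  negate = map negateTerm

  vector-negate : ∀ {n} es (l : Fin n) → vector (negate es) l ≈ - vector es l
  vector-negate []       l = K.sym -0#≈0#
  vector-negate (e ∷ es) l = K.trans
    (+-cong (single-neg (proj₁ e) l (unit-negateTerm e)) (vector-negate es l))
    (-‿+-comm _ _)

  support : ∀ {n} → List (Term n) → Subset n
  support []             = ⊥
  support ((j , _) ∷ es) = insert j (support es)

  ∣support∣≤ : ∀ {n} (es : List (Term n)) → ∣ support es ∣ ≤ length es
  ∣support∣≤ {n} []       = ℕ.≤-reflexive (∣⊥∣≡0 n)
  ∣support∣≤     (e ∷ es) = ℕ.≤-trans (∣insert∣≤ (proj₁ e) (support es)) (s≤s (∣support∣≤ es))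

  vector-∉ : ∀ {n} es {l : Fin n} → l ∉ support es → vector es l ≈ 0#
  vector-∉ []             l∉ = K.refl
  vector-∉ ((j , c) ∷ es) {l} l∉ = K.trans
    (+-cong (single-≢ j l (unit c) (λ { refl → l∉ (∈-insert j _) }))
            (vector-∉ es (l∉ ∘ ⊆-insert j _)))
    (+-identityˡ _)

  Ascending : ∀ {n} → List (Term n) → Set
  Ascending = AllPairs (Fin._<_ on proj₁)

  vector-below : ∀ {n} es {l : Fin n} → All (λ e → l Fin.< proj₁ e) es → vector es l ≈ 0#
  vector-below []             []        = K.refl
  vector-below ((j , c) ∷ es) {l} (l<j ∷ a) = K.trans
    (+-cong (single-≢ j l (unit c) (λ { refl → ℕ.<-irrefl refl l<j })) (vector-below es a))
    (+-identityˡ _)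

  vector-head : ∀ {n} {j : Fin n} {c} es → All (λ e → j Fin.< proj₁ e) es →
                vector ((j , c) ∷ es) j ≈ unit c
  vector-head {j = j} es a = K.trans (+-cong (single-≡ j _) (vector-below es a)) (+-identityʳ _)

  -- The first nonzero entry of the vector reveals the head of an ascending list; it is cancelled
  -- and the tails are compared. Since coefficients are stored as numbers, the lists are equal and
  -- not merely equivalent.
  vector-injective : ∀ {n} {es fs : List (Term n)} → Ascending es → Ascending fs →
                     (∀ l → vector es l ≈ vector fs l) → es ≡ fs
  vector-injective []                []                eq = refl
  vector-injective []       (_∷_ {x = j , c} {xs = fs} a fs↑) eq =
    contradiction (K.trans (K.sym (vector-head fs a)) (K.sym (eq j))) (unit≉0 c)
  vector-injective (_∷_ {x = j , c} {xs = es} a es↑) []       eq =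
    contradiction (K.trans (K.sym (vector-head es a)) (eq j)) (unit≉0 c)
  vector-injective (_∷_ {x = j , c} {xs = es} a es↑) (_∷_ {x = i , b} {xs = fs} a′ fs↑) eq
    with Finₚ.<-cmp j i
  ... | tri< j<i _ _ = contradiction
    (K.trans (K.sym (vector-head es a)) (K.trans (eq j)
      (vector-below ((i , b) ∷ fs) (j<i ∷ All.map (ℕ.<-trans j<i) a′)))) (unit≉0 c)
  ... | tri> _ _ i<j = contradiction
    (K.trans (K.sym (vector-head fs a′)) (K.trans (K.sym (eq i))
      (vector-below ((j , c) ∷ es) (i<j ∷ All.map (ℕ.<-trans i<j) a)))) (unit≉0 b)
  ... | tri≈ _ refl _
    with refl ← unit-injective {c} {b}
      (K.trans (K.sym (vector-head es a)) (K.trans (eq j) (vector-head fs a′)))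
    = cong (_ ∷_) (vector-injective es↑ fs↑ (λ l → +-cancelˡ _ _ _ (eq l)))

  shift : ∀ {n} → List (Term n) → List (Term (suc n))
  shift = map (map₁ suc)

  length-shift : ∀ {n} (es : List (Term n)) → length (shift es) ≡ length es
  length-shift = length-map (map₁ suc)

  vector-shift-zero : ∀ {n} (es : List (Term n)) → vector (shift es) zero ≈ 0#
  vector-shift-zero []       = K.refl
  vector-shift-zero (e ∷ es) = K.trans (+-identityˡ _) (vector-shift-zero es)

  vector-shift-suc : ∀ {n} es (l : Fin n) → vector (shift es) (suc l) ≈ vector es l
  vector-shift-suc []       l = K.refl
  vector-shift-suc (e ∷ es) l = +-congˡ (vector-shift-suc es l)

  shift-ascending : ∀ {n} {es : List (Term n)} → Ascending es → Ascending (shift es)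
  shift-ascending = AllPairsₚ.map⁺ ∘ AllPairs.map s≤s

  terms : ∀ {n} → Vector Carrier n → List (Term n)
  terms {zero}  x = []
  terms {suc n} x with x zero ≈? 0#
  ... | yes _  = shift (terms (x ∘ suc))
  ... | no x≉0 = (zero , proj₁ (unit-surjective _ x≉0)) ∷ shift (terms (x ∘ suc))

  vector-terms : ∀ {n} (x : Vector Carrier n) l → vector (terms x) l ≈ x l
  vector-terms {suc n} x l with x zero ≈? 0# | l
  ... | yes x≈0 | zero  = K.trans (vector-shift-zero (terms (x ∘ suc))) (K.sym x≈0)
  ... | yes x≈0 | suc l = K.trans (vector-shift-suc (terms (x ∘ suc)) l) (vector-terms (x ∘ suc) l)
  ... | no  x≉0 | zero  = K.trans
    (+-cong (proj₂ (unit-surjective _ x≉0)) (vector-shift-zero (terms (x ∘ suc)))) (+-identityʳ _)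
  ... | no  x≉0 | suc l = K.trans (+-identityˡ _)
    (K.trans (vector-shift-suc (terms (x ∘ suc)) l) (vector-terms (x ∘ suc) l))

  terms-ascending : ∀ {n} (x : Vector Carrier n) → Ascending (terms x)
  terms-ascending {zero}  x = []
  terms-ascending {suc n} x with x zero ≈? 0#
  ... | yes _ = shift-ascending (terms-ascending (x ∘ suc))
  ... | no  _ =
    Allₚ.map⁺ (All.tabulate (λ _ → s≤s z≤n)) ∷ shift-ascending (terms-ascending (x ∘ suc))

  length-terms : ∀ {n} (x : Vector Carrier n) S → (∀ j → j ∉ S → x j ≈ 0#) →
                 length (terms x) ≤ ∣ S ∣
  length-terms {zero}  x S       x≈0 = z≤n
  length-terms {suc n} x (s ∷ S) x≈0 with x zero ≈? 0# | s | x≈0 zero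
    | length-terms (x ∘ suc) S (λ j j∉ → x≈0 (suc j) (λ { (there j∈) → j∉ j∈ }))
  ... | yes _  | outside | _  | ih rewrite length-shift (terms (x ∘ suc)) = ih
  ... | yes _  | inside  | _  | ih rewrite length-shift (terms (x ∘ suc)) =
    ℕ.m≤n⇒m≤1+n ih
  ... | no x≉0 | outside | x₀ | ih = contradiction (x₀ λ ()) x≉0
  ... | no x≉0 | inside  | _  | ih rewrite length-shift (terms (x ∘ suc)) = s≤s ih

  module _ {d n : ℕ} (A : Matrix F d n) where

    combination : List (Term n) → Vector Carrier d
    combination []             i = 0#
    combination ((j , c) ∷ es) i = unit c *ᶠ A i j +ᶠ combination es i

    combination-sum : ∀ es i → sum (λ l → vector es l *ᶠ A i l) ≈ combination es i
    combination-sum []             i = sum-zero (λ l → zeroˡ (A i l))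
    combination-sum ((j , c) ∷ es) i = begin
      sum (λ l → (single j (unit c) l +ᶠ vector es l) *ᶠ A i l)
        ≈⟨ Sumₚ.sum-cong-≋ (λ l → distribʳ (A i l) _ _) ⟩
      sum (λ l → single j (unit c) l *ᶠ A i l +ᶠ vector es l *ᶠ A i l)
        ≈⟨ Sumₚ.∑-distrib-+ (λ l → single j (unit c) l *ᶠ A i l) (λ l → vector es l *ᶠ A i l) ⟩
      sum (λ l → single j (unit c) l *ᶠ A i l) +ᶠ sum (λ l → vector es l *ᶠ A i l)
        ≈⟨ +-cong (sum-single j (unit c) (A i)) (combination-sum es i) ⟩
      unit c *ᶠ A i j +ᶠ combination es i ∎
      where open SetoidReasoning setoidᶠ

    combination-++ : ∀ es fs i →
      combination (es ++ fs) i ≈ combination es i +ᶠ combination fs i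
    combination-++ []       fs i = K.sym (+-identityˡ _)
    combination-++ (e ∷ es) fs i =
      K.trans (+-congˡ (combination-++ es fs i)) (K.sym (+-assoc _ _ _))

    combination-negate : ∀ es i → combination (negate es) i ≈ - combination es i
    combination-negate []       i = K.sym -0#≈0#
    combination-negate (e ∷ es) i = K.trans
      (+-cong (K.trans (*-congʳ (unit-negateTerm e)) (K.sym (-‿distribˡ-* _ _)))
              (combination-negate es i))
      (-‿+-comm _ _)

    -- A dependency is cut in the middle: its first b terms and the negatives of
    -- the others have the same combination.
    separated⇒independent : ∀ {a b k} → a + b ≡ k → 1 ≤ b →
      (∀ es fs → Ascending es → Ascending fs → length es ≤ b → length fs ≤ a → es ≢ fs →
        ¬ (∀ i → combination es i ≈ combination fs i)) →
      AllIndependent F A k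
    separated⇒independent {a} {suc b} {k} a+b≡k _ separated S ∣S∣≡k x x≈0 Ax≈0 j j∈S
      with terms x | vector-terms x | terms-ascending x | length-terms x S x≈0
    ... | []     | vx | _       | _   = K.sym (vx j)
    ... | e ∷ es | vx | e<es ∷ es↑ | es≤ = contradiction same (separated us (negate ws)
        (AllPairsₚ.take⁺ (suc b) (e<es ∷ es↑)) (AllPairsₚ.map⁺ (AllPairsₚ.drop⁺ b es↑))
        (ℕ.≤-trans (ℕ.≤-reflexive (length-take (suc b) (e ∷ es))) (ℕ.m⊓n≤m _ _)) ws≤a
        (us≢ (Allₚ.drop⁺ b e<es)))
      where
      us ws : List (Term n)
      us = take (suc b) (e ∷ es)
      ws = drop b es

      ws≤a : length (negate ws) ≤ a
      ws≤a = begin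
        length (negate ws)     ≡⟨ length-map negateTerm ws ⟩
        length ws              ≡⟨ length-drop b es ⟩
        length (e ∷ es) ∸ suc b ≤⟨ ℕ.∸-monoˡ-≤ (suc b) es≤ ⟩
        ∣ S ∣ ∸ suc b          ≡⟨ cong (_∸ suc b) (trans ∣S∣≡k (sym a+b≡k)) ⟩
        a + suc b ∸ suc b      ≡⟨ ℕ.m+n∸n≡m a (suc b) ⟩
        a                      ∎
        where open ℕ.≤-Reasoning

      -- All columns of the second part come after that of `e`, which the first part contains
      -- because `1 ≤ b`. If the second part is empty, only one of the lists is.
      us≢ : ∀ {ws} → All (λ f → proj₁ e Fin.< proj₁ f) ws → us ≢ negate ws
      us≢ {_ ∷ _} (e<f ∷ _) eq = ℕ.<-irrefl (cong (toℕ ∘ proj₁) (∷-injectiveˡ eq)) e<f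

      same : ∀ i → combination us i ≈ combination (negate ws) i
      same i = K.trans (+-inverseˡ-unique _ _ total) (K.sym (combination-negate ws i))
        where
        open SetoidReasoning setoidᶠ
        total : combination us i +ᶠ combination ws i ≈ 0#
        total = begin
          combination us i +ᶠ combination ws i   ≈⟨ combination-++ us ws i ⟨
          combination (us ++ ws) i
            ≡⟨ cong (λ fs → combination fs i) (take++drop≡id (suc b) (e ∷ es)) ⟩
          combination (e ∷ es) i                 ≈⟨ combination-sum (e ∷ es) i ⟨
          sum (λ l → vector (e ∷ es) l *ᶠ A i l) ≈⟨ Sumₚ.sum-cong-≋ (λ l → *-congʳ (vx l)) ⟩
          sum (λ l → x l *ᶠ A i l)               ≈⟨ Ax≈0 i ⟩
          0#                                     ∎

    -- The difference of the two combinations involves at most `r` columns, so independence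
    -- annihilates its coefficients; ascending lists with the same vector are equal.
    independent⇒separated : ∀ {r} → r ≤ n → AllIndependent F A r →
      ∀ {es fs} → Ascending es → Ascending fs → length es + length fs ≤ r → es ≢ fs →
      ¬ (∀ i → combination es i ≈ combination fs i)
    independent⇒separated {r} r≤n indep {es} {fs} es↑ fs↑ len≤r es≢fs same =
      es≢fs (vector-injective es↑ fs↑ equal)
      where
      ds = es ++ negate fs

      ds≤r : length ds ≤ r
      ds≤r = ℕ.≤-trans (ℕ.≤-reflexive (trans (length-++ es)
        (cong (length es +_) (length-map negateTerm fs)))) len≤r

      vanishes : ∀ l → vector ds l ≈ 0#
      -- `AllIndependent` speaks of exactly `r` columns, so the support is padded; `r ≤ n` leaves
      -- room for that.
      vanishes l with enlarge (support ds) (ℕ.≤-trans (∣support∣≤ ds) ds≤r) r≤n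
      ... | S , ds⊆S , ∣S∣≡r with l ∈? S
      ...   | no  l∉S = vector-∉ ds (l∉S ∘ ds⊆S)
      ...   | yes l∈S = indep S ∣S∣≡r (vector ds) (λ j j∉ → vector-∉ ds (j∉ ∘ ds⊆S))
        (λ i → K.trans (combination-sum ds i) (K.trans (combination-++ es (negate fs) i)
          (K.trans (+-cong (same i) (combination-negate fs i)) (-‿inverseʳ _)))) l l∈S

      equal : ∀ l → vector es l ≈ vector fs l
      equal l = x∙y⁻¹≈ε⇒x≈y _ _ (K.trans (+-congˡ (K.sym (vector-negate fs l)))
        (K.trans (K.sym (vector-++ es (negate fs) l)) (vanishes l)))

-- Array updates and the numbering of tree nodes

≔-here : ∀ {X : Set} (f : ℕ → X) x {a} → (f [ x ↦ a ]) x ≡ a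
≔-here f x {a} = cong (if_then a else f x) (dec-true (x ℕ.≟ x) refl)

≔-there : ∀ {X : Set} (f : ℕ → X) {x y a} → x ≢ y → (f [ x ↦ a ]) y ≡ f y
≔-there f {x} {y} {a} x≢y = cong (if_then a else f y) (dec-false (x ℕ.≟ y) x≢y)

-- Uniqueness of quotient and remainder, by taking one `Q` off both sides at a time.
digit-injective : ∀ Q {c c′} x x′ → c < Q → c′ < Q → c + Q * x ≡ c′ + Q * x′ → c ≡ c′ × x ≡ x′
digit-injective Q {c} {c′} zero zero c< c′< eq rewrite ℕ.*-zeroʳ Q =
  trans (sym (ℕ.+-identityʳ c)) (trans eq (ℕ.+-identityʳ c′)) , refl
digit-injective Q {c} {c′} zero (suc x′) c< c′< eq rewrite ℕ.*-zeroʳ Q | ℕ.+-identityʳ c =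
  contradiction (ℕ.≤-trans (ℕ.m≤m*n Q (suc x′)) (ℕ.≤-trans (ℕ.m≤n+m _ c′)
    (ℕ.≤-reflexive (sym eq)))) (ℕ.<⇒≱ c<)
digit-injective Q {c} {c′} (suc x) zero c< c′< eq rewrite ℕ.*-zeroʳ Q | ℕ.+-identityʳ c′ =
  contradiction (ℕ.≤-trans (ℕ.m≤m*n Q (suc x)) (ℕ.≤-trans (ℕ.m≤n+m _ c)
    (ℕ.≤-reflexive eq))) (ℕ.<⇒≱ c′<)
digit-injective Q {c} {c′} (suc x) (suc x′) c< c′< eq =
  map₂ (cong suc) (digit-injective Q x x′ c< c′< (ℕ.+-cancelʳ-≡ Q _ _
    (trans (sym (carry c x)) (trans eq (carry c′ x′)))))
  where
  carry : ∀ c x → c + Q * suc x ≡ c + Q * x + Q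
  carry c x = trans (cong (c +_) (trans (ℕ.*-suc Q x) (ℕ.+-comm Q _))) (sym (ℕ.+-assoc c _ Q))

digit-surjective : ∀ Q v {u} → u < Q * v → ∃ λ (c : Fin Q) → ∃ λ x → x < v × toℕ c + Q * x ≡ u
digit-surjective Q zero {u} u< = contradiction (ℕ.≤-trans u< (ℕ.≤-reflexive (ℕ.*-zeroʳ Q))) λ ()
digit-surjective Q (suc v) {u} u< with u ℕ.<? Q
... | yes u<Q = fromℕ< u<Q , 0 , s≤s z≤n ,
  trans (cong₂ _+_ (toℕ-fromℕ< u<Q) (ℕ.*-zeroʳ Q)) (ℕ.+-identityʳ u)
... | no  u≮Q =
  let Q≤u = ℕ.≮⇒≥ u≮Q
      c , x , x<v , eq = digit-surjective Q v (ℕ.+-cancelˡ-< Q _ _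
        (≡.subst₂ _<_ (sym (ℕ.m+[n∸m]≡n Q≤u)) (ℕ.*-suc Q v) u<))
  in c , suc x , s≤s x<v , (begin
    toℕ c + Q * suc x   ≡⟨ cong (toℕ c +_) (ℕ.*-suc Q x) ⟩
    toℕ c + (Q + Q * x) ≡⟨ ℕ.+-assoc (toℕ c) Q _ ⟨
    toℕ c + Q + Q * x   ≡⟨ cong (_+ Q * x) (ℕ.+-comm (toℕ c) Q) ⟩
    Q + toℕ c + Q * x   ≡⟨ ℕ.+-assoc Q (toℕ c) _ ⟩
    Q + (toℕ c + Q * x) ≡⟨ cong (Q +_) eq ⟩
    Q + (u ∸ Q)         ≡⟨ ℕ.m+[n∸m]≡n Q≤u ⟩
    u                   ∎)
  where open ≡.≡-Reasoning

module Tree (Q n : ℕ) where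

  Path : Set
  Path = List (Fin n × Fin Q)

  -- A mixed-radix number whose order is that of three nested loops: parent outermost, then column,
  -- then coefficient.
  position : (c j p : ℕ) → ℕ
  position c j p = c + Q * (j + n * p)

  -- The children of node p of the complete Qn-ary tree are the nodes
  -- p Q n + 1 , … , p Q n + Q n.
  encode : Path → ℕ
  encode []             = 0
  encode ((j , c) ∷ es) = suc (position (toℕ c) (toℕ j) (encode es))

  -- The number of nodes of depth at most `i`. By `encode<` and `decode`, these nodes are exactly
  -- the ones numbered below it.
  levels : ℕ → ℕ
  levels zero    = 1
  levels (suc i) = suc (Q * n * levels i)

  position-injective : ∀ {c j p c′ j′ p′} → c < Q → c′ < Q → j < n → j′ < n →
    position c j p ≡ position c′ j′ p′ → c ≡ c′ × j ≡ j′ × p ≡ p′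
  position-injective {j = j} {p} {j′ = j′} {p′} c< c′< j< j′< eq
    with refl , eq′ ← digit-injective Q (j + n * p) (j′ + n * p′) c< c′< eq
    = refl , digit-injective n p p′ j< j′< eq′

  p≤position : ∀ {c j} p → c < Q → j < n → p ≤ position c j p
  p≤position {c} {j} p (s≤s _) (s≤s _) =
    ℕ.≤-trans (ℕ.m≤n*m p n) (ℕ.≤-trans (ℕ.m≤n+m _ j) (ℕ.≤-trans (ℕ.m≤n*m _ Q) (ℕ.m≤n+m _ c)))

  position< : ∀ {c j} p → c < Q → j < n → position c j p < Q * n * suc p
  position< {c} {j} p c<Q j<n = begin-strict
    c + Q * (j + n * p) <⟨ ℕ.+-monoˡ-< _ c<Q ⟩
    Q + Q * (j + n * p) ≡⟨ ℕ.*-suc Q _ ⟨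
    Q * suc (j + n * p) ≤⟨ ℕ.*-monoʳ-≤ Q (ℕ.+-monoˡ-≤ (n * p) j<n) ⟩
    Q * (n + n * p)     ≡⟨ cong (Q *_) (ℕ.*-suc n p) ⟨
    Q * (n * suc p)     ≡⟨ ℕ.*-assoc Q n _ ⟨
    Q * n * suc p       ∎
    where open ℕ.≤-Reasoning

  uncons : ∀ es {c j p} → c < Q → j < n → encode es ≡ suc (position c j p) →
    ∃ λ j′ → ∃ λ c′ → ∃ λ es′ → es ≡ (j′ , c′) ∷ es′ × toℕ c′ ≡ c × toℕ j′ ≡ j × encode es′ ≡ p
  uncons ((j′ , c′) ∷ es) c<Q j<n eq = j′ , c′ , es , refl ,
    position-injective (toℕ<n c′) c<Q (toℕ<n j′) j<n (ℕ.suc-injective eq)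

  encode-injective : ∀ es fs → encode es ≡ encode fs → es ≡ fs
  encode-injective []       []             eq = refl
  encode-injective es ((i , b) ∷ fs) eq
    with j , c , es′ , refl , c≡ , j≡ , p≡ ← uncons es (toℕ<n b) (toℕ<n i) eq
    = cong₂ _∷_ (cong₂ _,_ (toℕ-injective j≡) (toℕ-injective c≡)) (encode-injective es′ fs p≡)

  encode< : ∀ es {i} → length es ≤ i → encode es < levels i
  encode< []             {zero}  _ = s≤s z≤n
  encode< []             {suc i} _ = s≤s z≤n
  encode< ((j , c) ∷ es) {suc i} (s≤s len≤i) =
    s≤s (ℕ.<-≤-trans (position< (encode es) (toℕ<n c) (toℕ<n j))
      (ℕ.*-monoʳ-≤ (Q * n) (encode< es len≤i)))

  decode : ∀ i {t} → t < levels i → ∃ λ es → length es ≤ i × encode es ≡ t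
  decode i       {zero}  t<        = [] , z≤n , refl
  decode zero    {suc t} (s≤s ())
  decode (suc i) {suc t} (s≤s t<)
    with c , x , x< , refl ← digit-surjective Q (n * levels i)
      (ℕ.≤-trans t< (ℕ.≤-reflexive (ℕ.*-assoc Q n (levels i))))
    with j , p , p< , refl ← digit-surjective n (levels i) x<
    with es , len≤i , refl ← decode i p<
    = (j , c) ∷ es , s≤s len≤i , refl

  -- `n` exceeds every column number, so a path with a single term is never out of order.
  first : Path → ℕ
  first []            = n
  first ((j , _) ∷ _) = toℕ j

  parent : Path → ℕ
  parent []       = 0
  parent (_ ∷ es) = encode es

  -- Counts the neighbours that do not ascend strictly: truncated subtraction serves as comparison,
  -- `1 ∸ (m ∸ j)` being 1 if `m ≤ j` and 0 otherwise.
  disorder : Path → ℕ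
  disorder []             = 0
  disorder ((j , c) ∷ es) = disorder es + (1 ∸ (first es ∸ toℕ j))

  Tabulates : (ℕ → ℕ) → (Path → ℕ) → ℕ → Set
  Tabulates arr g t = ∀ es → encode es ≤ t → arr (encode es) ≡ g es

  tabulates-suc : ∀ arr {g t u a} → u ≡ suc t → Tabulates arr g t →
    (∀ es → encode es ≡ suc t → a ≡ g es) → Tabulates (arr [ u ↦ a ]) g (suc t)
  tabulates-suc arr {g} {t} {a = a} refl tab new es es≤ with ℕ.m≤n⇒m<n∨m≡n es≤
  ... | inj₁ (s≤s es≤t) = trans
    (≔-there arr {suc t} {encode es} {a} (λ eq → ℕ.<-irrefl (sym eq) (s≤s es≤t)))
    (tab es es≤t)
  ... | inj₂ es≡ = trans (cong (arr [ suc t ↦ a ]) es≡) (trans (≔-here arr (suc t)) (new es es≡))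

-- Detecting conflicts with one number per bucket

module Scan (Q n : ℕ) (high f₀ : ℕ) (key weight : Tree.Path Q n → ℕ)
            (weight≤2 : ∀ es → weight es ≤ 2) where
  open Tree Q n

  Conflict : Path → Path → Set
  Conflict es fs = 3 ≤ weight es + weight fs × key es ≡ key fs

  Collision : Set
  Collision = ∃ λ es → ∃ λ fs →
    length es ≤ high × length fs ≤ high × encode es ≢ encode fs × Conflict es fs

  -- T holds the largest weight of a scanned node in each bucket, and f is the
  -- flag.
  Scanned : ℕ → (ℕ → ℕ) → ℕ → Set
  Scanned t T f =
    (∀ es → encode es < t → weight es ≤ T (key es)) ×
    (∀ x → T x ≡ 0 ⊎ ∃ λ es → encode es < t × length es ≤ high × key es ≡ x × weight es ≡ T x) ×
    (f ≡ 0 → f₀ ≡ 0 ×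
      (∀ es fs → encode es < encode fs → encode fs < t → ¬ Conflict es fs)) ×
    (f ≡ f₀ ⊎ Collision)

  scanned-0 : ∀ {T} → (∀ x → T x ≡ 0) → Scanned 0 T f₀
  scanned-0 T≡0 = (λ _ ()) , (λ x → inj₁ (T≡0 x)) , (λ f₀≡0 → f₀≡0 , λ _ _ _ ()) , inj₁ refl

  -- `w + (T x ∸ w)` is the maximum of `w` and `T x`, and `(w + T x) ∸ 2` is positive exactly if the
  -- weights reach 3. The heaviest node of a bucket is enough to remember: if any earlier node there
  -- conflicts with the new one, it does.
  scanned-suc : ∀ {T f x w} es → length es ≤ high → x ≡ key es → w ≡ weight es →
    Scanned (encode es) T f →
    Scanned (suc (encode es)) (T [ x ↦ w + (T x ∸ w) ]) (f + ((w + T x) ∸ 2))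
  scanned-suc {T} {f} es es≤ refl refl (lower , exact , clean , flagged) =
    lower′ , exact′ , clear′ , flag flagged
    where
    x = key es
    w = weight es
    t = encode es
    T′ = T [ x ↦ w + (T x ∸ w) ]

    T′x : T′ x ≡ w + (T x ∸ w)
    T′x = ≔-here T x

    old : ∀ fs → encode fs < suc t → encode fs < t ⊎ fs ≡ es
    old fs (s≤s fs≤t) with ℕ.m≤n⇒m<n∨m≡n fs≤t
    ... | inj₁ fs<t = inj₁ fs<t
    ... | inj₂ fs≡t = inj₂ (encode-injective fs es fs≡t)

    T≤T′ : ∀ y → T y ≤ T′ y
    T≤T′ y with x ℕ.≟ y
    ... | yes refl = ℕ.≤-trans (ℕ.m≤n+m∸n (T x) w) (ℕ.≤-reflexive (sym T′x))
    ... | no  x≢y  = ℕ.≤-reflexive (sym (≔-there T x≢y))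

    lower′ : ∀ fs → encode fs < suc t → weight fs ≤ T′ (key fs)
    lower′ fs fs< with old fs fs<
    ... | inj₁ fs<t = ℕ.≤-trans (lower fs fs<t) (T≤T′ (key fs))
    ... | inj₂ refl = ℕ.≤-trans (ℕ.m≤m+n w _) (ℕ.≤-reflexive (sym T′x))

    exact′ : ∀ y → T′ y ≡ 0 ⊎
      ∃ λ fs → encode fs < suc t × length fs ≤ high × key fs ≡ y × weight fs ≡ T′ y
    exact′ y with x ℕ.≟ y
    exact′ y | no x≢y with exact y
    ... | inj₁ Ty≡0 = inj₁ (trans (≔-there T x≢y) Ty≡0)
    ... | inj₂ (fs , fs<t , fs≤ , key≡ , w≡) =
      inj₂ (fs , ℕ.m<n⇒m<1+n fs<t , fs≤ , key≡ , trans w≡ (sym (≔-there T x≢y)))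
    exact′ y | yes refl with T x ℕ.≤? w
    ... | yes Tx≤w = inj₂ (es , ℕ.≤-refl , es≤ , refl ,
      sym (trans T′x (trans (cong (w +_) (ℕ.m≤n⇒m∸n≡0 Tx≤w)) (ℕ.+-identityʳ w))))
    ... | no  Tx≰w with exact x
    ...   | inj₁ Tx≡0 = contradiction (ℕ.≤-trans (ℕ.≤-reflexive Tx≡0) z≤n) Tx≰w
    ...   | inj₂ (fs , fs<t , fs≤ , key≡ , w≡) = inj₂ (fs , ℕ.m<n⇒m<1+n fs<t , fs≤ , key≡ ,
      trans w≡ (sym (trans T′x (ℕ.m+[n∸m]≡n (ℕ.≰⇒≥ Tx≰w)))))

    clear′ : f + ((w + T x) ∸ 2) ≡ 0 → f₀ ≡ 0 ×
      (∀ gs fs → encode gs < encode fs → encode fs < suc t → ¬ Conflict gs fs)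
    clear′ f≡0 = proj₁ (clean (ℕ.m+n≡0⇒m≡0 f f≡0)) , separate
      where
      separate : ∀ gs fs → encode gs < encode fs → encode fs < suc t → ¬ Conflict gs fs
      separate gs fs gs<fs fs< with old fs fs<
      ... | inj₁ fs<t = proj₂ (clean (ℕ.m+n≡0⇒m≡0 f f≡0)) gs fs gs<fs fs<t
      ... | inj₂ refl = λ (3≤ , key≡) → ℕ.<⇒≱ (ℕ.≤-trans 3≤ (ℕ.≤-trans
        (ℕ.+-monoˡ-≤ w (ℕ.≤-trans (lower gs gs<fs) (ℕ.≤-reflexive (cong T key≡))))
        (ℕ.≤-reflexive (ℕ.+-comm (T x) w))))
        (ℕ.m∸n≡0⇒m≤n (ℕ.m+n≡0⇒n≡0 f f≡0))

    flag : f ≡ f₀ ⊎ Collision → f + ((w + T x) ∸ 2) ≡ f₀ ⊎ Collision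
    flag flagged with flagged | (w + T x) ℕ.≤? 2
    ... | inj₂ collision | _ = inj₂ collision
    ... | inj₁ f≡f₀ | yes ≤2 =
      inj₁ (trans (cong (f +_) (ℕ.m≤n⇒m∸n≡0 ≤2)) (trans (ℕ.+-identityʳ f) f≡f₀))
    ... | inj₁ f≡f₀ | no  ≰2 with exact x
    -- An empty bucket cannot raise the flag, since a single weight is at most 2.
    ...   | inj₁ Tx≡0 = contradiction (ℕ.≤-trans (ℕ.≤-reflexive
      (trans (cong (w +_) Tx≡0) (ℕ.+-identityʳ w))) (weight≤2 es)) ≰2
    ...   | inj₂ (fs , fs<t , fs≤ , key≡ , w≡) = inj₂ (es , fs , es≤ , fs≤ ,
      (λ eq → ℕ.<-irrefl (sym eq) fs<t) ,
      ℕ.≤-trans (ℕ.≰⇒> ≰2) (ℕ.≤-reflexive (cong (w +_) (sym w≡))) , sym key≡)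

-- Hoare triples with cost bounds

module Execution {q : ℕ} (F : FiniteField q) {d n : ℕ} (A : Matrix F d n)
                 (h : Fin (q ^ d) → ℕ) where
  open Machine F A

  -- The number of steps of the iterations is local to the definition of time;
  -- the proof of time-loop determines the term that is left open here.
  mutual
    iterations : (e : Expr) (s : Stmt) (σ : State) → ℕ → ℕ
    iterations e s σ m = _

    time-loop : ∀ e s σ → time h (loop e s) σ ≡ 1 + size e + iterations e s σ (⟦ e ⟧ σ)
    time-loop e s σ with ⟦ e ⟧ σ
    ... | m = refl

  -- Being a record type, a triple lets unification recover its conditions and its bound.
  record Spec (P : State → Set) (s : Stmt) (R : State → Set) (B : ℕ) : Set where
    constructor spec
    field
      apply : ∀ σ → P σ → R (exec h s σ) × time h s σ ≤ B

  open Spec public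

  infixr 2 _⨾ˢ_

  _⨾ˢ_ : ∀ {P R S s t B C} → Spec P s R B → Spec R t S C → Spec P (s ⨾ t) S (B + C)
  apply (p ⨾ˢ r) σ x =
    let y , cost = apply p σ x
        z , cost′ = apply r _ y
    in z , ℕ.+-mono-≤ cost cost′

  loop-spec : ∀ {e s B} m (I : ℕ → State → Set) →
    (∀ i → i < m → Spec (I i) s (I (suc i)) B) →
    Spec (λ σ → ⟦ e ⟧ σ ≡ m × I 0 σ) (loop e s) (I m) (1 + size e + m * (1 + B))
  apply (loop-spec {e} {s} {B} m I step) σ (refl , base) =
    proj₁ (go _ ℕ.≤-refl) , ℕ.≤-trans (ℕ.≤-reflexive (time-loop e s σ))
      (ℕ.+-monoʳ-≤ (1 + size e) (proj₂ (go _ ℕ.≤-refl)))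
    where
    go : ∀ i → i ≤ ⟦ e ⟧ σ → I i (fold σ (exec h s) i) × iterations e s σ i ≤ i * (1 + B)
    go zero    _   = base , z≤n
    go (suc i) i<m =
      let inv , cost = go i (ℕ.<⇒≤ i<m)
          inv′ , cost′ = apply (step i i<m) _ inv
      in inv′ , ℕ.≤-trans (ℕ.+-mono-≤ cost (s≤s cost′)) (ℕ.≤-reflexive (ℕ.+-comm (i * (1 + B)) _))

  weaken : ∀ {P P′ s R B} → (∀ {σ} → P′ σ → P σ) → Spec P s R B → Spec P′ s R B
  apply (weaken P′⇒P p) σ x = apply p σ (P′⇒P x)

  strengthen : ∀ {P s R R′ B} → (∀ {σ} → R σ → R′ σ) → Spec P s R B → Spec P s R′ B
  apply (strengthen R⇒R′ p) σ x = map₁ R⇒R′ (apply p σ x)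

-- The program

module Program (Q z : ℕ) where

  -- The first three numbers are dictated by the machine: `n` and `k` arrive in variables 1 and 2,
  -- and variable 0 is the output of both phases, first the number of buckets minus one and then the
  -- report.
  resultᵛ nᵛ kᵛ lowᵛ highᵛ spareᵛ branchingᵛ nodesᵛ innerᵛ accᵛ : ℕ
  resultᵛ    = 0
  nᵛ         = 1
  kᵛ         = 2
  lowᵛ       = 3
  highᵛ      = 4
  spareᵛ     = 5
  branchingᵛ = 6
  nodesᵛ     = 7
  innerᵛ     = 8
  accᵛ       = 9

  scaleᵛ nodeᵛ parentᵛ flagᵛ colᵛ codeᵛ cursorᵛ keyᵛ weightᵛ : ℕ
  scaleᵛ  = 10
  nodeᵛ   = 11
  parentᵛ = 12
  flagᵛ   = 13
  colᵛ    = 14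
  codeᵛ   = 15
  cursorᵛ = 16
  keyᵛ    = 17
  weightᵛ = 18

  parentᵃ colᵃ codeᵃ depthᵃ disorderᵃ tableᵃ : ℕ
  parentᵃ   = 0
  colᵃ      = 1
  codeᵃ     = 2
  depthᵃ    = 3
  disorderᵃ = 4
  tableᵃ    = 5

  -- Division by counting: a step takes `⌊ i /2⌋` and `⌈ i /2⌉` to `⌈ i /2⌉` and `⌊ i /2⌋ + 1`, the
  -- two halves of `suc i`.
  halveStep halve : Stmt
  halveStep =
    spareᵛ ≔ var highᵛ ⨾
    highᵛ ≔ var lowᵛ ⊕ lit 1 ⨾
    lowᵛ ≔ var spareᵛ
  halve = loop (var kᵛ) halveStep

  -- Products are repeated sums. `innerᵛ` lags one level behind `nodesᵛ` and ends as the number of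
  -- nodes that have children.
  addBranching addNodes countLevel count : Stmt
  addBranching = branchingᵛ ≔ var branchingᵛ ⊕ var nᵛ
  addNodes = accᵛ ≔ var accᵛ ⊕ var nodesᵛ
  countLevel =
    innerᵛ ≔ var nodesᵛ ⨾
    accᵛ ≔ lit 1 ⨾
    loop (var branchingᵛ) addNodes ⨾
    nodesᵛ ≔ var accᵛ
  count =
    branchingᵛ ≔ lit 0 ⨾
    loop (lit Q) addBranching ⨾
    innerᵛ ≔ lit 1 ⨾
    nodesᵛ ≔ lit 1 ⨾
    loop (var highᵛ) countLevel

  -- With `L` nodes, `100 L` is formed first and then added `L` times, so a quadratic number of
  -- buckets is computed in time linear in `L`.
  addScale addResult chooseBuckets : Stmt
  addScale = scaleᵛ ≔ var scaleᵛ ⊕ var nodesᵛ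
  addResult = resultᵛ ≔ var resultᵛ ⊕ var scaleᵛ
  chooseBuckets =
    scaleᵛ ≔ lit 0 ⨾
    loop (lit 100) addScale ⨾
    resultᵛ ≔ lit 0 ⨾
    loop (var nodesᵛ) addResult

  addRoot addNode addColumn addChildren grow : Stmt
  -- The root is its own parent and has the column number n, which is out of
  -- range and denotes 0: paths to the root may be followed for too long.
  addRoot =
    parentᵃ [ lit 0 ]≔ lit 0 ⨾
    colᵃ [ lit 0 ]≔ var nᵛ ⨾
    codeᵃ [ lit 0 ]≔ lit 0 ⨾
    depthᵃ [ lit 0 ]≔ lit 0 ⨾
    disorderᵃ [ lit 0 ]≔ lit 0 ⨾
    nodeᵛ ≔ lit 0 ⨾
    parentᵛ ≔ lit 0
  addNode =
    nodeᵛ ≔ var nodeᵛ ⊕ lit 1 ⨾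
    disorderᵃ [ var nodeᵛ ]≔
      disorderᵃ [ var parentᵛ ] ⊕ (lit 1 ⊖ (colᵃ [ var parentᵛ ] ⊖ var colᵛ)) ⨾
    depthᵃ [ var nodeᵛ ]≔ depthᵃ [ var parentᵛ ] ⊕ lit 1 ⨾
    -- Skips the number z of the element 0.
    codeᵃ [ var nodeᵛ ]≔ var codeᵛ ⊕ (lit 1 ⊖ (lit z ⊖ var codeᵛ)) ⨾
    colᵃ [ var nodeᵛ ]≔ var colᵛ ⨾
    parentᵃ [ var nodeᵛ ]≔ var parentᵛ ⨾
    codeᵛ ≔ var codeᵛ ⊕ lit 1
  addColumn =
    codeᵛ ≔ lit 0 ⨾
    loop (lit Q) addNode ⨾
    colᵛ ≔ var colᵛ ⊕ lit 1
  addChildren =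
    colᵛ ≔ lit 0 ⨾
    loop (var nᵛ) addColumn ⨾
    parentᵛ ≔ var parentᵛ ⊕ lit 1
  -- Parents are taken in the order of their numbers, so nodes arise breadth first and a plain
  -- counter produces the numbers of `encode`.
  grow = addRoot ⨾ loop (var innerᵛ) addChildren

  setup : Stmt
  setup =
    halve ⨾ count ⨾ chooseBuckets ⨾ grow ⨾
    nodeᵛ ≔ lit 0 ⨾
    flagᵛ ≔ var kᵛ ⊖ var nᵛ

  follow visit : Stmt
  follow =
    addCol 0 (codeᵃ [ var cursorᵛ ]) (colᵃ [ var cursorᵛ ]) ⨾
    cursorᵛ ≔ parentᵃ [ var cursorᵛ ]
  -- The weight of a node is 0 if its columns are not ascending, otherwise 2 or
  -- 1, according as its depth is at most ⌊ k /2⌋ or not.  Two nodes may not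
  -- share a bucket if their weights add up to at least 3.
  visit =
    clear 0 ⨾
    cursorᵛ ≔ var nodeᵛ ⨾
    loop (var highᵛ) follow ⨾
    hash keyᵛ 0 ⨾
    weightᵛ ≔ lit 1 ⊖ disorderᵃ [ var nodeᵛ ] ⨾
    weightᵛ ≔ var weightᵛ ⊕ (var weightᵛ ⊖ (depthᵃ [ var nodeᵛ ] ⊖ var lowᵛ)) ⨾
    -- The flag precedes the table update, so that a node is not compared with itself.
    flagᵛ ≔ var flagᵛ ⊕ ((var weightᵛ ⊕ tableᵃ [ var keyᵛ ]) ⊖ lit 2) ⨾
    tableᵃ [ var keyᵛ ]≔ var weightᵛ ⊕ (tableᵃ [ var keyᵛ ] ⊖ var weightᵛ) ⨾
    nodeᵛ ≔ var nodeᵛ ⊕ lit 1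

  main : Stmt
  main = loop (var nodesᵛ) visit ⨾ resultᵛ ≔ lit 1 ⊖ var flagᵛ

-- Correctness and cost of the first phase

module Setup {Q z : ℕ} {F : FiniteField (suc Q)} {d n k : ℕ} (A : Matrix F d n) where
  open Machine F A
  open Program Q z
  open Tree Q n

  h₀ : Fin (suc Q ^ d) → ℕ
  h₀ _ = 0
  open Execution F A h₀

  high low : ℕ
  high = ⌈ k /2⌉
  low  = ⌊ k /2⌋

  Clean Input Initial Halved Counted Prepared : State → Set
  Clean σ = ∀ x → arrs σ tableᵃ x ≡ 0
  Input σ = Clean σ × vars σ nᵛ ≡ n × vars σ kᵛ ≡ k
  Initial σ = Input σ × vars σ lowᵛ ≡ 0 × vars σ highᵛ ≡ 0
  Halved σ = Input σ × vars σ lowᵛ ≡ low × vars σ highᵛ ≡ high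
  Counted σ = Halved σ × vars σ nodesᵛ ≡ levels high × vars σ innerᵛ ≡ levels (pred high)
  Prepared σ = Counted σ × vars σ resultᵛ ≡ levels high * (100 * levels high)

  -- The sums are bracketed as the programs are nested, so that composing the triples yields them
  -- directly. A loop of `m` iterations contributes `2 + m * (1 + body)`.
  halveCost countCost chooseCost growCost setupCost visitCost mainCost : ℕ
  halveCost  = 2 + k * 9
  countCost  = 2 + (2 + Q * 5 + (2 + (2 + (2 + high * (1 + (2 + (2 + (2 + Q * n * 5 + 2))))))))
  chooseCost = 2 + (2 + 100 * 5 + (2 + (2 + levels high * 5)))
  growCost   =
    19 + (2 + levels (pred high) * (1 + (2 + (2 + n * (1 + (2 + (2 + Q * 41 + 4))) + 4))))
  setupCost  = halveCost + (countCost + (chooseCost + (growCost + 6)))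
  visitCost  = d + (2 + (2 + high * (1 + (4 + d + 3)) + (d + 35)))
  mainCost   = 2 + levels high * (1 + visitCost) + 4

  halve-spec : Spec Initial halve Halved halveCost
  halve-spec = weaken (λ (inp , low₀ , high₀) → proj₂ (proj₂ inp) , inp , low₀ , high₀)
    (loop-spec k (λ i τ → Input τ × vars τ lowᵛ ≡ ⌊ i /2⌋ × vars τ highᵛ ≡ ⌈ i /2⌉)
      λ i _ → spec λ σ (inp , l , h) → (inp , h , trans (ℕ.+-comm _ 1) (cong suc l)) , ℕ.≤-refl)

  Level : ℕ → State → Set
  Level i σ = Halved σ × vars σ branchingᵛ ≡ Q * n ×
    vars σ nodesᵛ ≡ levels i × vars σ innerᵛ ≡ levels (pred i)

  countLevel-spec : ∀ i → Spec (Level i) countLevel (Level (suc i)) (2 + (2 + (2 + Q * n * 5 + 2)))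
  countLevel-spec i =
    spec {R = λ σ → Start σ × vars σ innerᵛ ≡ levels i}
      (λ σ (hal , br , nod , _) → ((hal , br , nod) , nod) , ℕ.≤-refl) ⨾ˢ
    spec {R = λ σ → vars σ branchingᵛ ≡ Q * n × Added 0 σ}
      (λ σ ((hal , br , nod) , inn) → (br , (hal , br , nod) , inn , refl) , ℕ.≤-refl) ⨾ˢ
    loop-spec (Q * n) Added (λ j _ → spec λ σ ((hal , br , nod) , inn , acc) →
      ((hal , br , nod) , inn ,
       trans (cong₂ _+_ acc nod) (cong suc (ℕ.+-comm (j * levels i) _))) , ℕ.≤-refl) ⨾ˢ
    spec λ σ ((hal , br , _) , inn , acc) → (hal , br , acc , inn) , ℕ.≤-refl
    where
    Start : State → Set
    Start σ = Halved σ × vars σ branchingᵛ ≡ Q * n × vars σ nodesᵛ ≡ levels i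
    Added : ℕ → State → Set
    Added j σ = Start σ × vars σ innerᵛ ≡ levels i × vars σ accᵛ ≡ suc (j * levels i)

  count-spec : Spec Halved count Counted
    countCost
  count-spec =
    -- The trivial equation is what `loop-spec` asks about the iteration count of a literal.
    spec {R = λ σ → Q ≡ Q × Branching 0 σ} (λ σ hal → (refl , hal , refl) , ℕ.≤-refl) ⨾ˢ
    loop-spec Q Branching (λ i _ → spec λ σ (hal , br) →
      (hal , trans (cong₂ _+_ br (proj₁ (proj₂ (proj₁ hal)))) (ℕ.+-comm (i * n) n)) , ℕ.≤-refl) ⨾ˢ
    spec {R = λ σ → Branching Q σ × vars σ innerᵛ ≡ 1} (λ σ br → (br , refl) , ℕ.≤-refl) ⨾ˢ
    spec {R = λ σ → vars σ highᵛ ≡ high × Level 0 σ}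
      (λ σ ((hal , br) , inn) → (proj₂ (proj₂ hal) , hal , br , refl , inn) , ℕ.≤-refl) ⨾ˢ
    strengthen (λ (hal , _ , nod , inn) → hal , nod , inn)
      (loop-spec high Level (λ i _ → countLevel-spec i))
    where
    Branching : ℕ → State → Set
    Branching i σ = Halved σ × vars σ branchingᵛ ≡ i * n

  chooseBuckets-spec : Spec Counted chooseBuckets Prepared
    chooseCost
  chooseBuckets-spec =
    spec {R = λ σ → 100 ≡ 100 × Scaled 0 σ} (λ σ c → (refl , c , refl) , ℕ.≤-refl) ⨾ˢ
    loop-spec 100 Scaled (λ i _ → spec λ σ (c , s) →
      (c , trans (cong₂ _+_ s (proj₁ (proj₂ c))) (ℕ.+-comm (i * levels high) _)) , ℕ.≤-refl) ⨾ˢ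
    spec {R = λ σ → vars σ nodesᵛ ≡ levels high × Bucketed 0 σ}
      (λ σ (c , s) → (proj₁ (proj₂ c) , (c , s) , refl) , ℕ.≤-refl) ⨾ˢ
    strengthen (λ ((c , _) , r) → c , r)
      (loop-spec (levels high) Bucketed (λ i _ → spec λ σ ((c , s) , r) →
        ((c , s) , trans (cong₂ _+_ r s) (ℕ.+-comm (i * (100 * levels high)) _)) , ℕ.≤-refl))
    where
    Scaled Bucketed : ℕ → State → Set
    Scaled i σ = Counted σ × vars σ scaleᵛ ≡ i * levels high
    Bucketed i σ = Scaled 100 σ × vars σ resultᵛ ≡ i * (100 * levels high)

  -- The coefficient as the machine numbers it, with `z` skipped. At the root the value is
  -- multiplied by the zero column.
  codeOf : Path → ℕ
  codeOf []             = 0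
  codeOf ((_ , c) ∷ es) = toℕ c + (1 ∸ (z ∸ toℕ c))

  Filled : ℕ → State → Set
  Filled t σ =
    Tabulates (arrs σ parentᵃ) parent t × Tabulates (arrs σ colᵃ) first t ×
    Tabulates (arrs σ codeᵃ) codeOf t × Tabulates (arrs σ depthᵃ) length t ×
    Tabulates (arrs σ disorderᵃ) disorder t

  Growing : (t p : ℕ) → State → Set
  Growing t p σ = Prepared σ × Filled t σ × vars σ nodeᵛ ≡ t × vars σ parentᵛ ≡ p

  AtCode : (p j c : ℕ) → State → Set
  AtCode p j c σ = Growing (position c j p) p σ × vars σ colᵛ ≡ j × vars σ codeᵛ ≡ c

  addNode-spec : ∀ p j c → c < Q → j < n → Spec (AtCode p j c) addNode (AtCode p j (suc c)) 40
  addNode-spec p j c c<Q j<n = spec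
    λ σ ((prep , (par , fst , cod , dep , dis) , nod , pnt) , col , code) →
    let new : ∀ {g : Path → ℕ} {a} →
          (∀ j′ c′ es → toℕ c′ ≡ c → toℕ j′ ≡ j → encode es ≡ p → a ≡ g ((j′ , c′) ∷ es)) →
          ∀ es → encode es ≡ suc (position c j p) → a ≡ g es
        new = λ eq es es≡ → case uncons es c<Q j<n es≡ of λ
          { (j′ , c′ , es′ , refl , c≡ , j≡ , p≡) → eq j′ c′ es′ c≡ j≡ p≡ }
        -- The parent's number is at most that of the last finished node, so its entries are already
        -- in place.
        at-parent : ∀ arr {g es} → Tabulates arr g (position c j p) → encode es ≡ p →
          arr (vars σ parentᵛ) ≡ g es
        at-parent = λ arr {_} {es} tab p≡ → trans (cong arr (trans pnt (sym p≡)))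
          (tab es (ℕ.≤-trans (ℕ.≤-reflexive p≡) (p≤position p c<Q j<n)))
        nod′ = trans (ℕ.+-comm _ 1) (cong suc nod)
    in ((prep ,
         ( tabulates-suc (arrs σ parentᵃ) nod′ par (new {parent} λ _ _ _ _ _ p≡ →
             trans pnt (sym p≡))
         , tabulates-suc (arrs σ colᵃ) nod′ fst (new {first} λ _ _ _ _ j≡ _ → trans col (sym j≡))
         , tabulates-suc (arrs σ codeᵃ) nod′ cod (new {codeOf} λ _ _ _ c≡ _ _ →
             cong (λ x → x + (1 ∸ (z ∸ x))) (trans code (sym c≡)))
         , tabulates-suc (arrs σ depthᵃ) nod′ dep (new {length} λ _ _ _ _ _ p≡ →
             trans (ℕ.+-comm _ 1) (cong suc (at-parent (arrs σ depthᵃ) dep p≡)))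
         , tabulates-suc (arrs σ disorderᵃ) nod′ dis (new {disorder} λ _ _ _ _ j≡ p≡ →
             cong₂ _+_ (at-parent (arrs σ disorderᵃ) dis p≡) (cong (1 ∸_)
               (cong₂ _∸_ (at-parent (arrs σ colᵃ) fst p≡) (trans col (sym j≡)))))
         ) , nod′ , pnt) , col , trans (ℕ.+-comm _ 1) (cong suc code)) , ℕ.≤-refl

  AtColumn : (p j : ℕ) → State → Set
  AtColumn p j σ = Growing (position 0 j p) p σ × vars σ colᵛ ≡ j

  addColumn-spec : ∀ p j → j < n →
    Spec (AtColumn p j) addColumn (AtColumn p (suc j)) (2 + (2 + Q * 41 + 4))
  addColumn-spec p j j<n =
    spec {R = λ σ → Q ≡ Q × AtCode p j 0 σ} (λ σ (g , col) → (refl , g , col , refl) , ℕ.≤-refl) ⨾ˢ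
    loop-spec Q (AtCode p j) (λ c c<Q → addNode-spec p j c c<Q j<n) ⨾ˢ
    spec λ σ (g , col , _) →
      -- The coefficient digit carries: `position Q j p` equals `position 0 (suc j) p`.
      (≡.subst (λ t → Growing t p σ) (sym (ℕ.*-suc Q (j + n * p))) g ,
       trans (ℕ.+-comm _ 1) (cong suc col)) ,
      ℕ.≤-refl

  AtParent : ℕ → State → Set
  AtParent p = Growing (position 0 0 p) p

  addChildren-spec : ∀ p → Spec (AtParent p) addChildren (AtParent (suc p))
    (2 + (2 + n * (1 + (2 + (2 + Q * 41 + 4))) + 4))
  addChildren-spec p =
    spec {R = λ σ → vars σ nᵛ ≡ n × AtColumn p 0 σ}
      (λ σ g → (proj₁ (proj₂ (proj₁ (proj₁ (proj₁ (proj₁ g))))) , g , refl) , ℕ.≤-refl) ⨾ˢ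
    loop-spec n (AtColumn p) (λ j j<n → addColumn-spec p j j<n) ⨾ˢ
    spec λ σ (g , _) → (case ≡.subst (λ t → Growing t p σ) (cong (Q *_) (sym (ℕ.*-suc n p))) g of λ
      (prep , fil , nod , pnt) → (prep , fil , nod , trans (ℕ.+-comm _ 1) (cong suc pnt))) , ℕ.≤-refl

  grow-spec : 1 ≤ high → Spec Prepared grow (λ σ → Prepared σ × Filled (pred (levels high)) σ)
    growCost
  grow-spec 1≤high =
    spec {R = λ σ → vars σ innerᵛ ≡ levels (pred high) × AtParent 0 σ}
      (λ σ prep → (proj₂ (proj₂ (proj₁ prep)) ,
        ≡.subst (λ t → Growing t 0 (exec h₀ addRoot σ)) (sym position-0) (prep ,
         ((λ { [] _ → refl }) , (λ { [] _ → proj₁ (proj₂ (proj₁ (proj₁ (proj₁ prep)))) }) ,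
          (λ { [] _ → refl }) , (λ { [] _ → refl }) , (λ { [] _ → refl })), refl , refl)) , ℕ.≤-refl) ⨾ˢ
    strengthen (λ {σ} (prep , fil , _) → prep , ≡.subst (λ t → Filled t σ) (last 1≤high) fil)
      (loop-spec (levels (pred high)) AtParent (λ p _ → addChildren-spec p))
    where
    position-0 : position 0 0 0 ≡ 0
    position-0 = trans (cong (Q *_) (ℕ.*-zeroʳ n)) (ℕ.*-zeroʳ Q)
    -- The children of the last inner node end with the last node of the tree.
    last : ∀ {i} → 1 ≤ i → position 0 0 (levels (pred i)) ≡ pred (levels i)
    last {suc i} _ = sym (ℕ.*-assoc Q n (levels i))

  Ready : State → Set
  Ready σ = Prepared σ × Filled (pred (levels high)) σ × vars σ nodeᵛ ≡ 0 × vars σ flagᵛ ≡ k ∸ n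

  setup-spec : 1 ≤ high →
    Spec Initial setup Ready setupCost
  setup-spec 1≤high =
    halve-spec ⨾ˢ count-spec ⨾ˢ chooseBuckets-spec ⨾ˢ grow-spec 1≤high ⨾ˢ
    spec λ σ (prep , fil) → (prep , fil , refl ,
      cong₂ _∸_ (proj₂ (proj₂ (proj₁ (proj₁ (proj₁ prep)))))
                (proj₁ (proj₂ (proj₁ (proj₁ (proj₁ prep)))))) , ℕ.≤-refl {6}

-- Functions and skipped numbers as arithmetic codes

funToFin-cong : ∀ {m n} {f g : Fin m → Fin n} → (∀ i → f i ≡ g i) → funToFin f ≡ funToFin g
funToFin-cong {zero}  eq = refl
funToFin-cong {suc m} eq = cong₂ combine (eq zero) (funToFin-cong (eq ∘ suc))

funToFin-injective : ∀ {m n} {f g : Fin m → Fin n} → funToFin f ≡ funToFin g → ∀ i → f i ≡ g i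
funToFin-injective {f = f} {g} eq i =
  trans (sym (Finₚ.finToFun-funToFin f i))
    (trans (cong (λ x → finToFun x i) eq) (Finₚ.finToFun-funToFin g i))

-- The correction is 1 exactly if `j` has reached `i`; this is the expression by which the program
-- skips the number of 0.
toℕ-punchIn : ∀ {n} (i : Fin (suc n)) j → toℕ (punchIn i j) ≡ toℕ j + (1 ∸ (toℕ i ∸ toℕ j))
toℕ-punchIn zero    j       = trans (ℕ.+-comm 1 (toℕ j))
  (cong (λ x → toℕ j + (1 ∸ x)) (sym (ℕ.0∸n≡0 (toℕ j))))
toℕ-punchIn (suc i) zero    = sym (ℕ.0∸n≡0 (toℕ i))
toℕ-punchIn (suc i) (suc j) = cong suc (toℕ-punchIn i j)

-- Weights of paths

module Weights (Q n k : ℕ) where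
  open Tree Q n

  private
    low high : ℕ
    low  = ⌊ k /2⌋
    high = ⌈ k /2⌉

  weight : Path → ℕ
  weight es = let w = 1 ∸ disorder es in w + (w ∸ (length es ∸ low))

  weight≤2 : ∀ es → weight es ≤ 2
  weight≤2 es = ℕ.+-mono-≤ (ℕ.m∸n≤m 1 (disorder es))
    (ℕ.≤-trans (ℕ.m∸n≤m _ (length es ∸ low)) (ℕ.m∸n≤m 1 (disorder es)))

  1≤weight : ∀ es → disorder es ≡ 0 → 1 ≤ weight es
  1≤weight es eq rewrite eq = s≤s z≤n

  2≤weight : ∀ es → disorder es ≡ 0 → length es ≤ low → 2 ≤ weight es
  2≤weight es eq es≤ rewrite eq | ℕ.m≤n⇒m∸n≡0 es≤ = ℕ.≤-refl

  weight≤1 : ∀ es → low < length es → weight es ≤ 1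
  weight≤1 es low<es = ℕ.≤-trans (ℕ.≤-reflexive (trans (cong (w +_) (ℕ.m≤n⇒m∸n≡0 (ℕ.≤-trans
    (ℕ.m∸n≤m 1 (disorder es)) (ℕ.m<n⇒0<n∸m low<es)))) (ℕ.+-identityʳ w))) (ℕ.m∸n≤m 1 (disorder es))
    where w = 1 ∸ disorder es

  0<weight : ∀ es → 1 ≤ weight es → disorder es ≡ 0
  0<weight es 1≤w with disorder es
  ... | zero  = refl
  ... | suc m rewrite ℕ.0∸n≡0 m | ℕ.0∸n≡0 (length es ∸ low) = contradiction 1≤w λ ()

  -- As no weight exceeds 2, both are positive. Two weights of 1 do not reach 3, so one path has at
  -- most `⌊ k /2⌋` terms while the other has at most `⌈ k /2⌉`.
  heavy : ∀ es fs → 3 ≤ weight es + weight fs → length es ≤ high → length fs ≤ high →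
    disorder es ≡ 0 × disorder fs ≡ 0 × length es + length fs ≤ k
  heavy es fs 3≤ es≤ fs≤ =
    0<weight es (ℕ.+-cancelʳ-≤ 2 1 _ (ℕ.≤-trans 3≤ (ℕ.+-monoʳ-≤ (weight es) (weight≤2 fs)))) ,
    0<weight fs (ℕ.+-cancelˡ-≤ 2 1 _ (ℕ.≤-trans 3≤ (ℕ.+-monoˡ-≤ (weight fs) (weight≤2 es)))) ,
    short
    where
    short : length es + length fs ≤ k
    short with length es ℕ.≤? low | length fs ℕ.≤? low
    ... | yes es≤low | _ = ℕ.≤-trans (ℕ.+-mono-≤ es≤low fs≤) (ℕ.≤-reflexive (ℕ.⌊n/2⌋+⌈n/2⌉≡n k))
    ... | no  _ | yes fs≤low = ℕ.≤-trans (ℕ.+-mono-≤ es≤ fs≤low)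
      (ℕ.≤-reflexive (trans (ℕ.+-comm high low) (ℕ.⌊n/2⌋+⌈n/2⌉≡n k)))
    ... | no es≰ | no fs≰ = contradiction
      (ℕ.≤-trans 3≤ (ℕ.+-mono-≤ (weight≤1 es (ℕ.≰⇒> es≰)) (weight≤1 fs (ℕ.≰⇒> fs≰))))
      λ { (s≤s (s≤s ())) }

-- Correctness and cost of the second phase

module Pass {Q : ℕ} (F : FiniteField (suc Q)) {d n k : ℕ} (A : Matrix F d n)
            (h : Fin (suc Q ^ d) → ℕ) where
  open FiniteField F using
    ( Carrier; _≈_; _+ᶠ_; _*ᶠ_; 0#; enumeration
    ; +-cong; +-congˡ; *-cong; +-identityˡ; +-identityʳ; +-assoc; zeroʳ )
  private module K = FiniteField F
  open Inverse enumeration using (to; from; to-cong)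
  open Sparse F
  open Machine F A
  open Program Q (toℕ zeroCode)
  open Tree Q n
  open Weights Q n k using (weight; weight≤2)
  open Setup {z = toℕ zeroCode} {F = F} {k = k} A hiding (h₀)
  open Execution F A h

  element-toℕ : ∀ c → element (toℕ c) ≡ from c
  element-toℕ c with toℕ c ℕ.<? suc Q
  ... | yes c<q = cong from (fromℕ<-toℕ c c<q)
  ... | no  c≮q = contradiction (toℕ<n c) c≮q

  column-toℕ : ∀ j i → column (toℕ j) i ≡ A i j
  column-toℕ j i with toℕ j ℕ.<? n
  ... | yes j<n = cong (A i) (fromℕ<-toℕ j j<n)
  ... | no  j≮n = contradiction (toℕ<n j) j≮n

  column-n : ∀ i → column n i ≡ 0#
  column-n i with n ℕ.<? n
  ... | yes n<n = contradiction n<n (ℕ.<-irrefl refl)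
  ... | no  _   = refl

  element-codeOf : ∀ j c es → element (codeOf ((j , c) ∷ es)) ≡ unit c
  element-codeOf j c es = trans (cong element (sym (toℕ-punchIn zeroCode c))) (element-toℕ _)

  index-cong : ∀ {v w} → (∀ i → v i ≈ w i) → index v ≡ index w
  index-cong eq = funToFin-cong (to-cong ∘ eq)

  index-injective : ∀ {v w} → index v ≡ index w → ∀ i → v i ≈ w i
  index-injective eq i = to-injective (funToFin-injective eq i)

  key : Path → ℕ
  key es = h (index (combination A es))

  open Scan Q n high (k ∸ n) key weight weight≤2

  last : ℕ
  last = pred (levels high)

  Constants : State → Set
  Constants σ = vars σ lowᵛ ≡ low × vars σ highᵛ ≡ high × Filled last σ

  Visiting : ℕ → State → Set
  Visiting t σ = Constants σ × vars σ nodeᵛ ≡ t × Scanned t (arrs σ tableᵃ) (vars σ flagᵛ)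

  visit-spec : ∀ t → t < levels high → Spec (Visiting t) visit (Visiting (suc t)) visitCost
  visit-spec t t< with es , es≤high , refl ← decode high t< =
    spec {R = λ σ → Visiting t₀ σ × (∀ i → vecs σ 0 i ≈ 0#)}
      (λ σ v → (v , λ i → K.refl) , ℕ.≤-refl) ⨾ˢ
    spec {R = λ σ → vars σ highᵛ ≡ high × Following 0 σ}
      (λ σ (v , vec) → (proj₁ (proj₂ (proj₁ v)) , v , es ,
        ℕ.≤-trans (ℕ.≤-reflexive (ℕ.+-identityʳ _)) es≤high , ℕ.≤-refl , proj₁ (proj₂ v) ,
        λ i → K.trans (+-cong (vec i) K.refl) (+-identityˡ _)) , ℕ.≤-refl) ⨾ˢ
    loop-spec high Following (λ i i<high → follow-spec i i<high) ⨾ˢ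
    spec {R = λ σ → Visiting t₀ σ × vars σ keyᵛ ≡ key es}
      (λ σ (v , fs , fs≤ , _ , _ , sum) → (v , cong h (index-cong (collected fs fs≤ sum))) , ℕ.≤-refl) ⨾ˢ
    spec λ σ (((lo , hi , fil) , nod , scan) , ky) →
      ((lo , hi , fil) , trans (ℕ.+-comm _ 1) (cong suc nod) ,
       scanned-suc es es≤high ky (weight-read σ lo fil nod) scan) , ℕ.≤-refl
    where
    t₀ = encode es

    t₀≤last : t₀ ≤ last
    t₀≤last = ℕ.<⇒≤pred t<

    -- The vector and the rest `fs` of the path together give the whole combination. The rest is
    -- never longer than the number of iterations left, so it ends empty; `encode fs ≤ t₀` keeps it
    -- within the filled arrays.
    Following : ℕ → State → Set
    Following i σ = Visiting t₀ σ × ∃ λ fs → length fs + i ≤ high × encode fs ≤ t₀ ×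
      vars σ cursorᵛ ≡ encode fs × (∀ r → vecs σ 0 r +ᶠ combination A fs r ≈ combination A es r)

    collected : ∀ {v : Vec} fs → length fs + high ≤ high →
      (∀ r → v r +ᶠ combination A fs r ≈ combination A es r) → ∀ r → v r ≈ combination A es r
    collected []       _   sum r = K.trans (K.sym (+-identityʳ _)) (sum r)
    collected (_ ∷ fs) fs≤ sum r =
      contradiction (ℕ.≤-trans (s≤s (ℕ.m≤n+m high (length fs))) fs≤) (ℕ.<-irrefl refl)

    weight-read : ∀ σ → vars σ lowᵛ ≡ low → Filled last σ → vars σ nodeᵛ ≡ t₀ →
      let w = 1 ∸ arrs σ disorderᵃ (vars σ nodeᵛ)
      in w + (w ∸ (arrs σ depthᵃ (vars σ nodeᵛ) ∸ vars σ lowᵛ)) ≡ weight es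
    weight-read σ lo (_ , _ , _ , dep , dis) nod
      rewrite nod | lo | dep es t₀≤last | dis es t₀≤last = refl

    follow-spec : ∀ i → i < high → Spec (Following i) follow (Following (suc i)) (4 + d + 3)
    follow-spec i i<high = spec λ
      { σ (v@((lo , hi , par , col , _) , _) , [] , fs≤ , code≤ , cur , sum) →
          (v , [] , i<high , z≤n , trans (cong (arrs σ parentᵃ) cur) (par [] z≤n) ,
           λ r →
             let zero-column = K.reflexive (trans (cong (λ j → column j r)
                   (trans (cong (arrs σ colᵃ) cur) (col [] z≤n))) (column-n r))
             in K.trans (+-cong (K.trans (+-congˡ
                  (K.trans (*-cong K.refl zero-column) (zeroʳ _))) (+-identityʳ _)) K.refl) (sum r)) ,
          ℕ.≤-refl
      ; σ (v@((lo , hi , par , col , cod , _) , _) , fs@((j , c) ∷ fs′) , fs≤ , code≤ , cur , sum) →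
          let fs≤last = ℕ.≤-trans code≤ t₀≤last in
          (v , fs′ , ℕ.≤-trans (ℕ.≤-reflexive (ℕ.+-suc (length fs′) i)) fs≤ ,
           ℕ.≤-trans (ℕ.≤-trans (p≤position _ (toℕ<n c) (toℕ<n j)) (ℕ.n≤1+n _)) code≤ ,
           trans (cong (arrs σ parentᵃ) cur) (par fs fs≤last) ,
           λ r →
             let coefficient = K.reflexive (trans (cong element
                   (trans (cong (arrs σ codeᵃ) cur) (cod fs fs≤last))) (element-codeOf j c fs′))
                 entry = K.reflexive (trans (cong (λ x → column x r)
                   (trans (cong (arrs σ colᵃ) cur) (col fs fs≤last))) (column-toℕ j r))
             in K.trans (+-assoc _ _ _)
                  (K.trans (+-congˡ (+-cong (*-cong coefficient entry) K.refl)) (sum r))) ,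
          ℕ.≤-refl }

  Finished : State → Set
  Finished σ = ∃ λ f → vars σ resultᵛ ≡ 1 ∸ f × Scanned (levels high) (arrs σ tableᵃ) f

  main-spec : 1 ≤ high → Spec Ready main
    Finished
    mainCost
  main-spec 1≤high =
    weaken (λ ((((inp , lo , hi) , nod , _) , _) , fil , zer , flg) →
        nod , (lo , hi , fil) , zer , ≡.subst (Scanned 0 _) (sym flg) (scanned-0 (proj₁ inp)))
      (loop-spec (levels high) Visiting visit-spec) ⨾ˢ
    spec λ σ (_ , _ , scan) → (_ , refl , scan) , ℕ.≤-refl

-- Counting the hash functions with a collision

lookup-injective : ∀ {X : Set} {xs : List X} → Unique xs → Injective _≡_ _≡_ (lookup xs)
lookup-injective (x∉ ∷ u) {zero}  {zero}  eq = refl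
lookup-injective (x∉ ∷ u) {zero}  {suc j} eq = contradiction eq (All.lookup x∉ (∈-lookup j))
lookup-injective (x∉ ∷ u) {suc i} {zero}  eq = contradiction (sym eq) (All.lookup x∉ (∈-lookup i))
lookup-injective (x∉ ∷ u) {suc i} {suc j} eq = cong suc (lookup-injective u eq)

-- A function that agrees at u and v is determined by u, v and the function
-- obtained by changing its value at u; the new value is arbitrary.
colliding≤ : ∀ {M b L} (g : Fin L → Fin M) (bad : List (Fin (b ^ M))) → Unique bad →
  (∀ {ω} → ω ∈ˡ bad → ∃ λ s → ∃ λ t → g s ≢ g t × finToFun {b} ω (g s) ≡ finToFun ω (g t)) →
  length bad * b ≤ L * L * b ^ M
-- The union bound over `L * L` pairs of collision probability `1 / b`, expressed as an injection
-- instead of a sum.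
colliding≤ {M} {b} {L} g bad unique collides = Finₚ.injective⇒≤ {f = code} code-injective
  where
  Code : Fin (length bad) → Fin b → Fin L → Fin L → Fin M → Fin b
  Code r y s t = updateAt (finToFun (lookup bad r)) (g s) (const y)

  code′ : Fin (length bad) → Fin b → Fin (L * L * b ^ M)
  code′ r y =
    let s , t , _ = collides (∈-lookup r) in combine (combine s t) (funToFin (Code r y s t))

  code : Fin (length bad * b) → Fin (L * L * b ^ M)
  code = uncurry code′ ∘ remQuot b

  code′-injective : ∀ r y r′ y′ → code′ r y ≡ code′ r′ y′ → (r , y) ≡ (r′ , y′)
  code′-injective r y r′ y′ eq with collides (∈-lookup r) | collides (∈-lookup r′)
  ... | s , t , gs≢gt , ωs≡ωt | s′ , t′ , _ , ω′s≡ω′t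
    with st≡ , funs≡ ← Finₚ.combine-injective (combine s t) _ (combine s′ t′) _ eq
    with refl , refl ← Finₚ.combine-injective s t s′ t′ st≡
    = cong₂ _,_ (lookup-injective unique ω≡) y≡
    where
    same : ∀ v → Code r y s t v ≡ Code r′ y′ s t v
    same = funToFin-injective funs≡

    y≡ : y ≡ y′
    y≡ = trans (sym (updateAt-updates (g s) _)) (trans (same (g s)) (updateAt-updates (g s) _))

    away : ∀ v → v ≢ g s → finToFun (lookup bad r) v ≡ finToFun (lookup bad r′) v
    away v v≢ = trans (sym (updateAt-minimal v (g s) _ v≢))
      (trans (same v) (updateAt-minimal v (g s) _ v≢))

    everywhere : ∀ v → finToFun (lookup bad r) v ≡ finToFun (lookup bad r′) v
    everywhere v with v Finₚ.≟ g s
    ... | no  v≢   = away v v≢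
    ... | yes refl = trans ωs≡ωt (trans (away (g t) (gs≢gt ∘ sym)) (sym ω′s≡ω′t))

    ω≡ : lookup bad r ≡ lookup bad r′
    ω≡ = trans (sym (Finₚ.funToFin-finToFin {M} {b} _))
      (trans (funToFin-cong everywhere) (Finₚ.funToFin-finToFin {M} {b} _))

  code-injective : Injective _≡_ _≡_ code
  code-injective {i} {j} eq = trans (sym (Finₚ.combine-remQuot {length bad} b i))
    (trans (cong (uncurry combine) (code′-injective _ _ _ _ eq))
      (Finₚ.combine-remQuot {length bad} b j))

≤-fraction : ∀ a b c N .{{_ : NonZero b}} .{{_ : NonZero N}} →
  a * N ≤ c * b → (ℤ.+ a / b) ≤ᵘ (ℤ.+ c / N)
≤-fraction a (suc b) c (suc N) le =
  *≤* (≡.subst₂ ℤ._≤_ (ℤₚ.pos-* a (suc N)) (ℤₚ.pos-* c (suc b)) (ℤ.+≤+ le))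

length-filter-≟ᴿ : ∀ {X : Set} (f : X → Report) xs →
  length (filter (λ x → f x ≟ᴿ atLeast) xs) + length (filter (λ x → f x ≟ᴿ lessThan) xs) ≡ length xs
length-filter-≟ᴿ f []       = refl
length-filter-≟ᴿ f (x ∷ xs) with f x
... | atLeast  = cong suc (length-filter-≟ᴿ f xs)
... | lessThan = trans (ℕ.+-suc _ _) (cong suc (length-filter-≟ᴿ f xs))

likely : ∀ {N} .{{_ : NonZero N}} (f : Fin N → Report) →
  100 * length (filter (λ ω → f ω ≟ᴿ lessThan) (allFin N)) ≤ N →
  (ℤ.+ 99 / 100) ≤ᵘ Pr (λ ω → f ω ≟ᴿ atLeast)
likely {N} f rare = ≤-fraction 99 100 good N (ℕ.+-cancelʳ-≤ (100 * bad) _ _ (begin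
  99 * N + 100 * bad     ≤⟨ ℕ.+-monoʳ-≤ (99 * N) rare ⟩
  99 * N + N             ≡⟨ ℕ.+-comm (99 * N) N ⟩
  100 * N                ≡⟨ cong (100 *_) total ⟨
  100 * (good + bad)     ≡⟨ ℕ.*-distribˡ-+ 100 good bad ⟩
  100 * good + 100 * bad ≡⟨ cong (_+ 100 * bad) (ℕ.*-comm 100 good) ⟩
  good * 100 + 100 * bad ∎))
  where
  open ℕ.≤-Reasoning
  good = length (filter (λ ω → f ω ≟ᴿ atLeast) (allFin N))
  bad = length (filter (λ ω → f ω ≟ᴿ lessThan) (allFin N))
  total : good + bad ≡ N
  total = trans (length-filter-≟ᴿ f (allFin N)) (length-tabulate {n = N} (λ i → i))

-- Replacing `b` by the smaller `100 L²` in `colliding≤` lets the factor `L²` cancel, which leaves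
-- the error 1/100.
rare-collisions : ∀ {M L b} → 1 ≤ L → b ≡ suc (L * (100 * L)) →
  (g : Fin L → Fin M) (bad : List (Fin (b ^ M))) → Unique bad →
  (∀ {ω} → ω ∈ˡ bad → ∃ λ s → ∃ λ t → g s ≢ g t × finToFun {b} ω (g s) ≡ finToFun ω (g t)) →
  100 * length bad ≤ b ^ M
rare-collisions {L = L@(suc _)} _ refl g bad unique collides =
  ℕ.*-cancelˡ-≤ (L * L) (ℕ.≤-trans (ℕ.≤-reflexive rearrange)
    (ℕ.≤-trans (ℕ.*-monoʳ-≤ (length bad) (ℕ.n≤1+n _)) (colliding≤ g bad unique collides)))
  where
  open +-*-Solver
  rearrange : L * L * (100 * length bad) ≡ length bad * (L * (100 * L))
  rearrange = solve 2 (λ l x → l :* l :* (con 100 :* x) := x :* (l :* (con 100 :* l)))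
    refl L (length bad)

-- One-sided error

-- The algorithm is a variable here, so the program cannot unfold and the argument rests on the two
-- specifications alone.
module Analysis {Q : ℕ} (F : FiniteField (suc Q)) {d n k : ℕ} (1≤k : 1 ≤ k)
  (A : Matrix F d n) (alg : Algorithm) {B C : ℕ}
  (setup-spec : Execution.Spec F A (Run.noHash F alg k A)
    (Setup.Initial {z = toℕ (Sparse.zeroCode F)} {k = k} A) (Algorithm.setup alg)
    (Setup.Ready {z = toℕ (Sparse.zeroCode F)} {k = k} A) B)
  (main-spec : ∀ ω → Execution.Spec F A (Run.hashFunction F alg k A ω)
    (Setup.Ready {z = toℕ (Sparse.zeroCode F)} {k = k} A) (Algorithm.main alg)
    (Pass.Finished F {k = k} A (Run.hashFunction F alg k A ω)) C)
  where
  open Sparse F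
  open Tree Q n
  open Machine F A
  open Run F alg k A
  open Setup {z = toℕ zeroCode} {F = F} {k = k} A using (Ready; low; high)
  private module P = Pass F {k = k} A

  ready-spec : Ready ready × time noHash (Algorithm.setup alg) initial ≤ B
  ready-spec = Execution.apply setup-spec initial (((λ _ → refl) , refl , refl) , refl , refl)

  buckets≡ : buckets ≡ suc (levels high * (100 * levels high))
  buckets≡ = cong suc (proj₂ (proj₁ (proj₁ ready-spec)))

  run-spec : ∀ ω → P.Finished (hashFunction ω) (exec (hashFunction ω) (Algorithm.main alg) ready)
    × time (hashFunction ω) (Algorithm.main alg) ready ≤ C
  run-spec ω = Execution.apply (main-spec ω) ready (proj₁ ready-spec)

  runtime≤ : ∀ ω → runtime ω ≤ B + C
  runtime≤ ω = ℕ.+-mono-≤ (proj₂ ready-spec) (proj₂ (run-spec ω))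

  report-zero : ∀ ω →
    vars (exec (hashFunction ω) (Algorithm.main alg) ready) 0 ≡ 0 → report ω ≡ lessThan
  report-zero ω eq with vars (exec (hashFunction ω) (Algorithm.main alg) ready) 0
  ... | zero = refl

  report-suc : ∀ ω {m} →
    vars (exec (hashFunction ω) (Algorithm.main alg) ready) 0 ≡ suc m → report ω ≡ atLeast
  report-suc ω eq with vars (exec (hashFunction ω) (Algorithm.main alg) ready) 0
  ... | suc _ = refl

  disorder⇒ascending : ∀ es → disorder es ≡ 0 → Ascending es
  disorder⇒ascending []             _  = []
  disorder⇒ascending ((j , c) ∷ es) eq = below es es↑ j<first ∷ es↑
    where
    es↑ = disorder⇒ascending es (ℕ.m+n≡0⇒m≡0 _ eq)
    j<first : toℕ j < first es
    j<first = ℕ.≰⇒> λ first≤j → contradiction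
      (trans (sym (cong (1 ∸_) (ℕ.m≤n⇒m∸n≡0 first≤j))) (ℕ.m+n≡0⇒n≡0 (disorder es) eq)) λ ()
    below : ∀ es → Ascending es → toℕ j < first es → All (λ e → j Fin.< proj₁ e) es
    below []       _         _   = []
    below (e ∷ es) (e< ∷ _)  j<e = j<e ∷ All.map (ℕ.<-trans j<e) e<

  ascending⇒disorder : ∀ {es} → Ascending es → disorder es ≡ 0
  ascending⇒disorder []                      = refl
  ascending⇒disorder (_∷_ {x = j , c} {es} j< es↑) =
    cong₂ _+_ (ascending⇒disorder es↑) (ℕ.m≤n⇒m∸n≡0 (ℕ.m<n⇒0<n∸m (j<first j<)))
    where
    j<first : ∀ {es} → All (λ e → j Fin.< proj₁ e) es → toℕ j < first es
    j<first []        = toℕ<n j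
    j<first (j<e ∷ _) = j<e

  open Weights Q n k

  1≤high : 1 ≤ high
  1≤high = ℕ.⌈n/2⌉-mono 1≤k

  -- Equal vectors share a bucket under every hash function. So a flag that stays 0 certifies
  -- `k ≤ n` and the independence of any `k` columns, contrary to `r < k`.
  rejects : ∀ r → IsKruskalRank F A r → r < k → ∀ ω → report ω ≡ lessThan
  rejects r (_ , maximal) r<k ω with run-spec ω
  ... | (suc f , eq , _) , _ = report-zero ω (trans eq (ℕ.0∸n≡0 f))
  ... | (zero , _ , _ , _ , clean , _) , _ with k∸n≡0 , separate ← clean refl =
    contradiction (maximal k (ℕ.m∸n≡0⇒m≤n k∸n≡0) independent) (ℕ.<⇒≱ r<k)
    where
    independent : AllIndependent F A k
    independent = separated⇒independent A (ℕ.⌊n/2⌋+⌈n/2⌉≡n k) 1≤high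
      λ es fs es↑ fs↑ es≤ fs≤ es≢fs same →
        let fs≤high = ℕ.≤-trans fs≤ (ℕ.⌊n/2⌋≤⌈n/2⌉ k)
            key≡ = cong (hashFunction ω) (P.index-cong (hashFunction ω) same)
            1≤ = 1≤weight es (ascending⇒disorder es↑)
            2≤ = 2≤weight fs (ascending⇒disorder fs↑) fs≤
        -- The scan excludes conflicts only for pairs listed in the order of their numbers.
        in case ℕ.<-cmp (encode es) (encode fs) of λ
          { (tri< es<fs _ _) → separate es fs es<fs (encode< fs fs≤high) (ℕ.+-mono-≤ 1≤ 2≤ , key≡)
          ; (tri≈ _ eq _)    → es≢fs (encode-injective es fs eq)
          ; (tri> _ _ fs<es) → separate fs es fs<es (encode< es es≤) (ℕ.+-mono-≤ 2≤ 1≤ , sym key≡)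
          }

  path : Fin (levels high) → Path
  path s = proj₁ (decode high (toℕ<n s))

  point : Fin (levels high) → Fin (suc Q ^ d)
  point s = index (combination A (path s))

  path-encode : ∀ es (es≤ : length es ≤ high) → path (fromℕ< (encode< es es≤)) ≡ es
  path-encode es es≤ = encode-injective _ _
    (trans (proj₂ (proj₂ (decode high (toℕ<n (fromℕ< (encode< es es≤)))))) (toℕ-fromℕ< _))

  -- The flag starts at 0 because `k ≤ r ≤ n`, so a raised flag exhibits two conflicting nodes.
  -- Independence makes their vectors different, so it is the hash function that collides.
  collides : ∀ r → IsKruskalRank F A r → k ≤ r → ∀ ω → report ω ≡ lessThan →
    ∃ λ s → ∃ λ t → point s ≢ point t × finToFun {buckets} ω (point s) ≡ finToFun ω (point t)
  collides r ((r≤n , independent) , _) k≤r ω less with run-spec ω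
  ... | (zero , eq , _) , _ = contradiction (trans (sym less) (report-suc ω eq)) λ ()
  ... | (suc f , _ , _ , _ , _ , inj₁ f≡) , _ =
    contradiction (trans f≡ (ℕ.m≤n⇒m∸n≡0 (ℕ.≤-trans k≤r r≤n))) λ ()
  ... | (suc f , _ , _ , _ , _ , inj₂ (es , fs , es≤ , fs≤ , codes≢ , 3≤ , key≡)) , _
    with es≡0 , fs≡0 , short ← heavy es fs 3≤ es≤ fs≤ =
      fromℕ< (encode< es es≤) , fromℕ< (encode< fs fs≤) ,
      ≡.subst₂ (λ es fs → index (combination A es) ≢ index (combination A fs)
          × finToFun {buckets} ω (index (combination A es)) ≡ finToFun ω (index (combination A fs)))
        (sym (path-encode es es≤)) (sym (path-encode fs fs≤))
        ( independent⇒separated A r≤n independent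
            (disorder⇒ascending es es≡0) (disorder⇒ascending fs fs≡0)
            (ℕ.≤-trans short k≤r) (λ { refl → codes≢ refl }) ∘ P.index-injective (hashFunction ω)
        , toℕ-injective key≡)

  accepts : ∀ r → IsKruskalRank F A r → k ≤ r → (ℤ.+ 99 / 100) ≤ᵘ Pr (λ ω → report ω ≟ᴿ atLeast)
  accepts r rank k≤r = likely report (rare-collisions (encode< [] {high} z≤n) buckets≡ point
    (filter (λ ω → report ω ≟ᴿ lessThan) (allFin Ω))
    (filter⁺ (λ ω → report ω ≟ᴿ lessThan) (allFin⁺ Ω))
    (λ {ω} ω∈ → collides r rank k≤r ω
      (proj₂ (∈-filter⁻ (λ ω → report ω ≟ᴿ lessThan) {xs = allFin Ω} ω∈))))

-- The runtime bound and its constant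

infixl 6 _+ᴼ_
infixl 7 _*ᴼ_

-- The bound is wrapped because a and b could not be inferred from (a + b) * D.
record O (D x c : ℕ) : Set where
  constructor bound
  field unbound : x ≤ c * D

const≤ : ∀ {D} → 1 ≤ D → ∀ c → O D c c
const≤ 1≤D c = bound (ℕ.≤-trans (ℕ.≤-reflexive (sym (ℕ.*-identityʳ c))) (ℕ.*-monoʳ-≤ c 1≤D))

unit≤ : ∀ {D x} → x ≤ D → O D x 1
unit≤ {D} x≤D = bound (ℕ.≤-trans x≤D (ℕ.≤-reflexive (sym (ℕ.*-identityˡ D))))

_+ᴼ_ : ∀ {D x y a b} → O D x a → O D y b → O D (x + y) (a + b)
_+ᴼ_ {D} {a = a} {b} (bound p) (bound q) =
  bound (ℕ.≤-trans (ℕ.+-mono-≤ p q) (ℕ.≤-reflexive (sym (ℕ.*-distribʳ-+ D a b))))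

_*ᴼ_ : ∀ {D E x y a b} → O D x a → O E y b → O (D * E) (x * y) (a * b)
_*ᴼ_ {D} {E} {a = a} {b} (bound p) (bound q) =
  bound (ℕ.≤-trans (ℕ.*-mono-≤ p q) (ℕ.≤-reflexive (ℕ.[m*n]*[o*p]≡[m*o]*[n*p] a D b E)))

times : ∀ {D x a} → O D x a → ∀ c → O D (x * c) (a * c)
times {D} {x} {a} (bound p) c = bound (ℕ.≤-trans (ℕ.*-monoˡ-≤ c p) (ℕ.≤-reflexive
  (solve 3 (λ a D c → a :* D :* c := a :* c :* D) refl a D c)))
  where open +-*-Solver

rebase : ∀ {D E x a} c → D ≤ c * E → O D x a → O E x (a * c)
rebase {E = E} {a = a} c D≤ (bound p) =
  bound (ℕ.≤-trans p (ℕ.≤-trans (ℕ.*-monoʳ-≤ a D≤) (ℕ.≤-reflexive (sym (ℕ.*-assoc a c E)))))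

module Runtime {Q : ℕ} (2≤Q : 2 ≤ Q) (F : FiniteField (suc Q)) {d n k : ℕ}
  (1≤d : 1 ≤ d) (1≤n : 1 ≤ n) (1≤k : 1 ≤ k) (A : Matrix F d n) where
  open Tree Q n
  open Setup {z = toℕ (Sparse.zeroCode F)} {F = F} {k = k} A hiding (h₀)

  X D : ℕ
  X = (n * Q) ^ high
  D = d * k * X

  1≤high : 1 ≤ high
  1≤high = ℕ.⌈n/2⌉-mono 1≤k

  1≤Q : 1 ≤ Q
  1≤Q = ℕ.≤-trans (s≤s z≤n) 2≤Q

  2≤nQ : 2 ≤ n * Q
  2≤nQ = ℕ.*-mono-≤ 1≤n 2≤Q

  1≤power : ∀ i → 1 ≤ (n * Q) ^ i
  1≤power zero    = ℕ.≤-refl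
  1≤power (suc i) = ℕ.*-mono-≤ (ℕ.≤-trans (s≤s z≤n) 2≤nQ) (1≤power i)

  -- The successor on the left makes the induction close: with `m = n * Q ≥ 2`, the next value
  -- `2 + m * levels i` is at most `m * suc (levels i)`.
  levels≤ : ∀ i → suc (levels i) ≤ 2 * (n * Q) ^ i
  levels≤ zero    = ℕ.≤-refl
  levels≤ (suc i) = begin
    2 + Q * n * levels i           ≡⟨ cong (λ m → 2 + m * levels i) (ℕ.*-comm Q n) ⟩
    2 + n * Q * levels i           ≤⟨ ℕ.+-monoˡ-≤ _ 2≤nQ ⟩
    n * Q + n * Q * levels i       ≡⟨ ℕ.*-suc (n * Q) (levels i) ⟨
    n * Q * suc (levels i)         ≤⟨ ℕ.*-monoʳ-≤ (n * Q) (levels≤ i) ⟩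
    n * Q * (2 * (n * Q) ^ i)
      ≡⟨ solve 2 (λ m x → m :* (con 2 :* x) := con 2 :* (m :* x)) refl (n * Q) ((n * Q) ^ i) ⟩
    2 * (n * Q * (n * Q) ^ i)      ∎
    where
    open ℕ.≤-Reasoning
    open +-*-Solver

  -- Growing costs `O(n Q)` per inner node; since every child is a node of its own, this adds up to
  -- the size of the tree.
  grown : ∀ {i} → 1 ≤ i → levels (pred i) * (n * Q) ≤ levels i
  grown {suc i} _ = ℕ.≤-trans (ℕ.≤-reflexive
    (trans (ℕ.*-comm (levels i) (n * Q)) (cong (_* levels i) (ℕ.*-comm n Q)))) (ℕ.n≤1+n _)

  nQ≤X : n * Q ≤ X
  nQ≤X = go 1≤high
    where
    go : ∀ {i} → 1 ≤ i → n * Q ≤ (n * Q) ^ i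
    go {suc i} _ = ℕ.m≤m*n (n * Q) _ {{>-nonZero (1≤power i)}}

  1≤X : 1 ≤ X
  1≤X = 1≤power high

  1≤dk : 1 ≤ d * k
  1≤dk = ℕ.*-mono-≤ 1≤d 1≤k

  X≤D : X ≤ D
  X≤D = ℕ.m≤n*m X (d * k) {{>-nonZero 1≤dk}}

  1≤D : 1 ≤ D
  1≤D = ℕ.≤-trans 1≤X X≤D

  k≤dk : k ≤ d * k
  k≤dk = ℕ.m≤n*m k d {{>-nonZero 1≤d}}

  d≤dk : d ≤ d * k
  d≤dk = ℕ.m≤m*n d k {{>-nonZero 1≤k}}

  k≤D : k ≤ D
  k≤D = ℕ.≤-trans k≤dk (ℕ.m≤m*n (d * k) X {{>-nonZero 1≤X}})

  Q≤D : Q ≤ D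
  Q≤D = ℕ.≤-trans (ℕ.m≤n*m Q n {{>-nonZero 1≤n}}) (ℕ.≤-trans nQ≤X X≤D)

  high≤k : high ≤ k
  high≤k = ℕ.⌈n/2⌉≤n k

  highnQ≤ : high * (Q * n) ≤ 1 * D
  highnQ≤ = ℕ.≤-trans
    (ℕ.*-mono-≤ (ℕ.≤-trans high≤k k≤dk) (ℕ.≤-trans (ℕ.≤-reflexive (ℕ.*-comm Q n)) nQ≤X))
    (ℕ.≤-reflexive (sym (ℕ.*-identityˡ D)))

  levels≤X : levels high ≤ 2 * X
  levels≤X = ℕ.≤-trans (ℕ.n≤1+n _) (levels≤ high)

  levels≤D : levels high ≤ 2 * D
  levels≤D = ℕ.≤-trans levels≤X (ℕ.*-monoʳ-≤ 2 X≤D)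

  halveO : O D halveCost _
  halveO = const≤ 1≤D 2 +ᴼ times (unit≤ k≤D) 9

  countO : O D countCost _
  countO =
    const≤ 1≤D 2 +ᴼ (const≤ 1≤D 2 +ᴼ times (unit≤ Q≤D) 5 +ᴼ
    (const≤ 1≤D 2 +ᴼ (const≤ 1≤D 2 +ᴼ (const≤ 1≤D 2 +ᴼ
    rebase 1 highnQ≤ (unit≤ (ℕ.≤-refl {high}) *ᴼ
      (c 1 +ᴼ (c 2 +ᴼ (c 2 +ᴼ (c 2 +ᴼ times (unit≤ ℕ.≤-refl) 5 +ᴼ c 2)))))))))
    where
    c : ∀ x → O (Q * n) x x
    c = const≤ (ℕ.*-mono-≤ 1≤Q 1≤n)

  chooseO : O D chooseCost _
  chooseO = const≤ 1≤D 2 +ᴼ (const≤ 1≤D (2 + 100 * 5) +ᴼ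
    (const≤ 1≤D 2 +ᴼ (const≤ 1≤D 2 +ᴼ times (bound {c = 2} levels≤D) 5)))

  growO : O D growCost _
  growO = const≤ 1≤D 19 +ᴼ (const≤ 1≤D 2 +ᴼ rebase 2 (ℕ.≤-trans (grown 1≤high) levels≤D)
    (unit≤ (ℕ.≤-refl {levels (pred high)}) *ᴼ (b 1 +ᴼ (b 2 +ᴼ (b 2 +ᴼ
      unit≤ (ℕ.≤-refl {n}) *ᴼ
        (c 1 +ᴼ (c 2 +ᴼ (c 2 +ᴼ times (unit≤ ℕ.≤-refl) 41 +ᴼ c 4))) +ᴼ b 4)))))
    where
    b : ∀ x → O (n * Q) x x
    b = const≤ (ℕ.*-mono-≤ 1≤n 1≤Q)
    c : ∀ x → O Q x x
    c = const≤ 1≤Q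

  setupO : O D setupCost _
  setupO = halveO +ᴼ (countO +ᴼ (chooseO +ᴼ (growO +ᴼ const≤ 1≤D 6)))

  -- The factor `d * k` comes from walking to the root: `⌈ k /2⌉` vector updates of cost about `d`.
  visitO : O (d * k) visitCost _
  visitO = dO +ᴼ (c 2 +ᴼ (c 2 +ᴼ rebase 1 highd≤ (unit≤ (ℕ.≤-refl {high}) *ᴼ
      (e 1 +ᴼ (e 4 +ᴼ unit≤ ℕ.≤-refl +ᴼ e 3))) +ᴼ (dO +ᴼ c 35)))
    where
    c : ∀ x → O (d * k) x x
    c = const≤ 1≤dk
    e : ∀ x → O d x x
    e = const≤ 1≤d
    dO : O (d * k) d 1
    dO = unit≤ d≤dk
    highd≤ : high * d ≤ 1 * (d * k)
    highd≤ = ℕ.≤-trans (ℕ.*-monoˡ-≤ d high≤k)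
      (ℕ.≤-reflexive (trans (ℕ.*-comm k d) (sym (ℕ.*-identityˡ (d * k)))))

  mainO : O D mainCost _
  mainO = const≤ 1≤D 2 +ᴼ
    rebase 1 (ℕ.≤-reflexive (trans (ℕ.*-comm X (d * k)) (sym (ℕ.*-identityˡ D))))
    (bound {D = X} {c = 2} levels≤X *ᴼ (const≤ 1≤dk 1 +ᴼ visitO)) +ᴼ const≤ 1≤D 4

  total : O D (setupCost + mainCost) 811
  -- The first phase contributes 703 and the second 108. The largest share, 518, is the choice of
  -- the number of buckets with its loop of 100 additions.
  total = setupO +ᴼ mainO

-- Only `Q` and the number of the field's 0 are built in, so one program serves all sizes and
-- matrices over the field.
algorithm : ∀ {Q} → FiniteField (suc Q) → Algorithm
algorithm {Q} F = record { setup = setup ; main = main }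
  where open Program Q (toℕ (Sparse.zeroCode F))

algorithm-correct : ∀ {Q} (F : FiniteField (suc Q)) → 2 ≤ Q →
  ∀ {d n k} → 1 ≤ d → 1 ≤ n → 1 ≤ k → (A : Matrix F d n) →
  let open Run F (algorithm F) k A in
  (∀ ω → runtime ω ≤ 811 * (d * k * (n * Q) ^ ⌈ k /2⌉))
  × (∀ r → IsKruskalRank F A r → r < k → ∀ ω → report ω ≡ lessThan)
  × (∀ r → IsKruskalRank F A r → k ≤ r → ℤ.+ 99 / 100 ≤ᵘ Pr (λ ω → report ω ≟ᴿ atLeast))
algorithm-correct {Q} F 2≤Q {d} {n} {k} 1≤d 1≤n 1≤k A =
  (λ ω → ℕ.≤-trans (runtime≤ ω) (O.unbound (Runtime.total 2≤Q F 1≤d 1≤n 1≤k A))) , rejects , accepts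
  where
  open Setup {z = toℕ (Sparse.zeroCode F)} {F = F} {k = k} A
  open Run F (algorithm F) k A using (hashFunction)
  1≤high : 1 ≤ ⌈ k /2⌉
  1≤high = ℕ.⌈n/2⌉-mono 1≤k
  open Analysis F 1≤k A (algorithm F) {B = setupCost} {C = mainCost} (setup-spec 1≤high)
    (λ ω → Pass.main-spec F {k = k} A (hashFunction ω) 1≤high)

open import Data.Integer.Base using (+_)

lemma10 : ∃ λ (C : ℕ) →
    (q : ℕ) (F : FiniteField q) → 2 < q →
    ∃ λ (alg : Algorithm) →
    (d n k : ℕ) → 1 ≤ d → 1 ≤ n → 1 ≤ k → (A : Matrix F d n) →
    let open Run F alg k A in
    (∀ ω → runtime ω ≤ C * (d * k * (n * (q ∸ 1)) ^ ⌈ k /2⌉))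
    × (∀ r → IsKruskalRank F A r → r < k → ∀ ω → report ω ≡ lessThan)
    × (∀ r → IsKruskalRank F A r → k ≤ r → + 99 / 100 ≤ᵘ Pr (λ ω → report ω ≟ᴿ atLeast))
lemma10 = 811 , λ { (suc Q) F (s≤s 2≤Q) →
  algorithm F , λ d n k 1≤d 1≤n 1≤k A → algorithm-correct F 2≤Q 1≤d 1≤n 1≤k A }
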